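{- Let $G$ be a finite simple graph with Dirac operator $D$, Dirac blocks $D_k=d_k^*d_k$ and squared analytic torsion $A(G)=\prod_{k}\mathrm{Det}(L_k)^{k(-1)^{k+1}}$. Then $$|\mathrm{Det}(D)|\cdot A(G)=\prod_{k\ \mathrm{even}}\mathrm{Det}(D_k)^2\qquad\text{and}\qquad |\mathrm{Det}(D)|/A(G)=\prod_{k\ \mathrm{odd}}\mathrm{Det}(D_k)^2 .$$
   Context: Let $G=(V,E)$ be a finite simple graph. A $k$-simplex of $G$ is (the vertex set of) a complete subgraph $K_{k+1}$; $f_k$ is the number of $k$-simplices, and $r$ is the maximal dimension of a simplex. Order the vertices; for a $(k+1)$-simplex $x=\{v_0<\dots<v_{k+1}\}$ and $y=x\setminus\{v_i\}$ put $\mathrm{sign}(y,x)=(-1)^i$. The exterior derivative $d_k$ is the $f_{k+1}\times f_k$ matrix given by $d_kf(x)=\sum_{y\subset x,\ \dim y=k}\mathrm{sign}(y,x)f(y)$ (with $d_{ -1}=0$, $d_r=0$). These assemble to an $n\times n$ matrix $d$ on the space of functions on all $n=\sum_k f_k$ simplices; $D=d+d^*$ is the Dirac operator and $L=D^2$ the Hodge Laplacian, with diagonal blocks $L_k=d_k^*d_k+d_{k-1}d_{k-1}^*$, $0\le k\le r$. The Dirac blocks are $D_k=d_k^*d_k$, $0\le k\le r$. The pseudo determinant $\mathrm{Det}(M)$ of a square matrix $M$ is the product of its non-zero eigenvalues, counted with multiplicity (equal to $1$ if there are none). -}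

module Defs where

open import Level using (0ℓ; _⊔_) renaming (suc to lsuc)
open import Algebra.Apartness.Bundles using (HeytingCommutativeRing; HeytingField)
open import Algebra.Bundles using (CommutativeRing; Semiring)
open import Data.Fin.Base using (Fin; zero; suc; toℕ; punchIn)
import Data.Fin.Properties as Fin
open import Data.Integer.Base as ℤ using (ℤ; +_; -[1+_])
open import Data.List.Base using (List; []; _∷_; _++_; allFin; concatMap; filter; foldr; length; lookup; map; removeAt; upTo)
open import Data.List.Extrema.Nat using (max)
open import Data.List.Properties using (≡-dec)
open import Data.List.Relation.Unary.AllPairs using (allPairs?)
open import Data.Nat.Base as ℕ using (ℕ; zero; suc)
import Data.Nat.Properties as ℕ
open import Data.Nat.Divisibility using (_∣?_)
open import Data.Product.Base using (_,_)
open import Data.Sum.Base using (_⊎_; inj₁; inj₂)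
open import Function.Base using (flip)
open import Relation.Binary.Core using (Rel)
open import Relation.Binary.Definitions using (Decidable; Irreflexive; Symmetric)
open import Relation.Binary.PropositionalEquality.Core using (_≡_)
open import Relation.Binary.Structures using (IsStrictPartialOrder)
open import Relation.Nullary.Decidable using (yes; no; ¬?)

------------------------------------------------------------------------
-- Ordered fields

-- The scalars are an arbitrary ordered field.  The order is not assumed
-- decidable, so that the classical reals, the constructive reals and the
-- (discrete) real algebraic numbers are all instances.

record OrderedField c ℓ₁ ℓ₂ ℓ₃ : Set (lsuc (c ⊔ ℓ₁ ⊔ ℓ₂ ⊔ ℓ₃)) where
  infix 4 _<_
  field
    heytingField : HeytingField c ℓ₁ ℓ₂
  open HeytingField heytingField public
  field
    _<_                  : Rel Carrier ℓ₃
    isStrictPartialOrder : IsStrictPartialOrder _≈_ _<_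
    #⇒<⊎>                : ∀ {x y} → x # y → x < y ⊎ y < x
    <⇒#                  : ∀ {x y} → x < y → x # y
    +-monoˡ-<            : ∀ z {x y} → x < y → x + z < y + z
    *-pos                : ∀ {x y} → 0# < x → 0# < y → 0# < x * y

  open HeytingCommutativeRing heytingCommutativeRing public
    using (commutativeRing)

------------------------------------------------------------------------
-- Finite simple graphs and their simplices

-- The vertices are ordered by the order of Fin n.

record SimpleGraph (n : ℕ) : Set₁ where
  field
    Adj        : Rel (Fin n) 0ℓ
    adj?       : Decidable Adj
    adj-sym    : Symmetric Adj
    adj-irrefl : Irreflexive _≡_ Adj

-- The m-element sublists of a list, each in the order of the list.

choose : ∀ {a} {A : Set a} → ℕ → List A → List (List A)
choose zero    _        = [] ∷ []
choose (suc m) []       = []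
choose (suc m) (v ∷ vs) = map (v ∷_) (choose m vs) ++ choose (suc m) vs

module Simplices {n : ℕ} (G : SimpleGraph n) where
  open SimpleGraph G

  -- A simplex is the increasing list v₀ < … < v_k of its vertices.
  Simplex : Set
  Simplex = List (Fin n)

  simplices : ℕ → List Simplex
  simplices k = filter (allPairs? adj?) (choose (suc k) (allFin n))

  f : ℕ → ℕ
  f k = length (simplices k)

  -- r + 1, where r is the maximal dimension of a simplex (and 0 for the
  -- graph without vertices); simplices k is empty for k ≥ n.
  levels : ℕ
  levels = max 0 (map suc (filter (λ k → 0 ℕ.<? f k) (upTo n)))

  dims evenDims oddDims : List ℕ
  dims     = upTo levels
  evenDims = filter (2 ∣?_) dims
  oddDims  = filter (λ k → ¬? (2 ∣? k)) dims

  allSimplices : List Simplex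
  allSimplices = concatMap simplices dims

------------------------------------------------------------------------
-- Matrices and pseudo determinants

module LinearAlgebra {c ℓ₁ ℓ₂ ℓ₃} (K : OrderedField c ℓ₁ ℓ₂ ℓ₃) where
  open OrderedField K hiding (zero)
  open CommutativeRing commutativeRing using (ring; semiring)
  open import Algebra.Definitions.RawSemiring (Semiring.rawSemiring semiring)
    using (sum; product) renaming (_^_ to _^ᴷ_)
  open import Algebra.Apartness.Properties.HeytingCommutativeRing heytingCommutativeRing
    using (1#0; x#0y#0→xy#0; #-congʳ; x-0≈x; invertibleˡ⇒#)
  open import Algebra.Properties.Ring ring using (-‿involutive; -‿distribˡ-*; -‿distribʳ-*)

  infixl 7 _⊗_
  infixl 6 _⊕_
  infix  9 _ᵀ

  Matrix : ℕ → ℕ → Set c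
  Matrix m n = Fin m → Fin n → Carrier

  _ᵀ : ∀ {m n} → Matrix m n → Matrix n m
  M ᵀ = flip M

  𝟘 : ∀ {m n} → Matrix m n
  𝟘 _ _ = 0#

  _⊕_ : ∀ {m n} → Matrix m n → Matrix m n → Matrix m n
  (M ⊕ N) i j = M i j + N i j

  _⊗_ : ∀ {l m n} → Matrix l m → Matrix m n → Matrix l n
  (M ⊗ N) i j = sum (λ k → M i k * N k j)

  -1^_ : ℕ → Carrier
  -1^ i = (- 1#) ^ᴷ i

  -- Laplace expansion along the first row.
  det : ∀ {n} → Matrix n n → Carrier
  det {zero}  M = 1#
  det {suc n} M = sum (λ j → -1^ (toℕ j) * (M zero j * det (λ i k → M (suc i) (punchIn j k))))

  scalar : ∀ {n} → Carrier → Matrix n n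
  scalar x i j with i Fin.≟ j
  ... | yes _ = x
  ... | no  _ = 0#

  -- The characteristic polynomial det (x I − M), as a polynomial function.
  -- An ordered field is infinite, so polynomials and polynomial functions
  -- over it are the same.
  charPoly : ∀ {n} → Matrix n n → Carrier → Carrier
  charPoly M x = det (λ i j → scalar x i j - M i j)

  record K× : Set (c ⊔ ℓ₂) where
    constructor _,_
    field
      val     : Carrier
      nonzero : val # 0#
  open K× public

  infix  4 _≈×_
  infixl 7 _·_
  infixl 7 _÷_
  infixr 8 _^_
  infix  8 _⁻¹

  _≈×_ : Rel K× ℓ₁
  a ≈× b = val a ≈ val b

  𝟙 : K×
  𝟙 = 1# , 1#0

  _·_ : K× → K× → K×
  (x , p) · (y , q) = x * y , x#0y#0→xy#0 p q

  _⁻¹ : K× → K×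
  (x , p) ⁻¹ with #⇒invertible p
  ... | x⁻¹ , _ , x⁻¹-inverseʳ = x⁻¹ , invertibleˡ⇒# (x - 0# , trans (*-congˡ (x-0≈x x⁻¹)) x⁻¹-inverseʳ)

  _÷_ : K× → K× → K×
  a ÷ b = a · b ⁻¹

  _^_ : K× → ℤ → K×
  a ^ (+ zero)     = 𝟙
  a ^ (+ suc m)    = a · a ^ (+ m)
  a ^ -[1+ zero ]  = a ⁻¹
  a ^ -[1+ suc m ] = a ⁻¹ · a ^ -[1+ m ]

  neg : K× → K×
  neg (x , p) = - x , #-congʳ (trans (sym (-‿distribˡ-* 1# x)) (-‿cong (*-identityˡ x)))
                              (x#0y#0→xy#0 -1#0 p)
    where
    -1#0 : - 1# # 0#
    -1#0 = invertibleˡ⇒# (- 1# , trans (*-congˡ (x-0≈x (- 1#)))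
             (trans (sym (-‿distribˡ-* 1# (- 1#)))
             (trans (-‿cong (*-identityˡ (- 1#))) (-‿involutive 1#))))

  ∣_∣ : K× → K×
  ∣ a ∣ with #⇒<⊎> (nonzero a)
  ... | inj₁ a<0 = neg a
  ... | inj₂ a>0 = a

  ∏ : ∀ {i} {I : Set i} → List I → (I → K×) → K×
  ∏ is g = foldr (λ i a → g i · a) 𝟙 is

  infix 3 ∏
  syntax ∏ is (λ i → a) = ∏[ i ← is ] a

  -- The eigenvalues of M in K, counted with (algebraic) multiplicity, each
  -- of them known to be zero or nonzero.
  record Spectrum {n : ℕ} (M : Matrix n n) : Set (c ⊔ ℓ₁ ⊔ ℓ₂) where
    field
      eigenvalue : Fin n → Carrier
      splits     : ∀ x → charPoly M x ≈ product (λ i → x - eigenvalue i)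
      zero⊎#     : ∀ i → eigenvalue i ≈ 0# ⊎ eigenvalue i # 0#

    nonzeroPart : Fin n → K×
    nonzeroPart i with zero⊎# i
    ... | inj₁ _ = 𝟙
    ... | inj₂ p = eigenvalue i , p

  -- The product of the nonzero eigenvalues.  It depends on M alone, up to
  -- _≈×_: the function charPoly M determines the eigenvalues as a multiset.
  Det : ∀ {n} {M : Matrix n n} → Spectrum M → K×
  Det {n} σ = ∏[ i ← allFin n ] Spectrum.nonzeroPart σ i

------------------------------------------------------------------------
-- Dirac operator and Hodge Laplacian

module Hodge {c ℓ₁ ℓ₂ ℓ₃} (K : OrderedField c ℓ₁ ℓ₂ ℓ₃) {n : ℕ} (G : SimpleGraph n) where
  open OrderedField K hiding (zero)
  open LinearAlgebra K public
  open Simplices G public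

  -- (-1)^i if y = x ∖ {v_i}, and 0 if y is not a codimension-one face of x.
  sign : Simplex → Simplex → Carrier
  sign y x with Fin.any? (λ i → ≡-dec Fin._≟_ (removeAt x i) y)
  ... | yes (i , _) = -1^ (toℕ i)
  ... | no  _       = 0#

  d[_] : ∀ k → Matrix (f (suc k)) (f k)
  d[ k ] i j = sign (lookup (simplices k) j) (lookup (simplices (suc k)) i)

  D[_] : ∀ k → Matrix (f k) (f k)
  D[ k ] = d[ k ] ᵀ ⊗ d[ k ]

  d₋₁d₋₁*[_] : ∀ k → Matrix (f k) (f k)
  d₋₁d₋₁*[ zero  ] = 𝟘
  d₋₁d₋₁*[ suc k ] = d[ k ] ⊗ d[ k ] ᵀ

  L[_] : ∀ k → Matrix (f k) (f k)
  L[ k ] = D[ k ] ⊕ d₋₁d₋₁*[ k ]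

  d : Matrix (length allSimplices) (length allSimplices)
  d i j = sign (lookup allSimplices j) (lookup allSimplices i)

  D : Matrix (length allSimplices) (length allSimplices)
  D = d ⊕ d ᵀ

  torsion² : (∀ k → Spectrum L[ k ]) → K×
  torsion² σ = ∏[ k ← dims ] Det (σ k) ^ (+ k ℤ.* (ℤ.-1ℤ ℤ.^ suc k))

{-# OPTIONS --safe #-}
module Submission where

-- Write ρ M y = det (1 - y M). It satisfies ρ (A B) = ρ (B A), and ρ (A + B) = ρ A ρ B
-- whenever A B = 0, while Det M is up to sign its leading coefficient. Since d d = 0,
-- this gives Det L_{k+1} = Det D_{k+1} Det D_k, so that A(G) telescopes to
-- ∏ Det (D_k)^((-1)^k). In the same way D² = d d* + d* d gives ρ (D²) = ρ (d d*)², and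
-- d d* is a sum of mutually orthogonal layers with ρ (d d*) = ∏ ρ D_k. As
-- ρ D y ρ D (- y) = ρ (D²) (y²), it follows that Det (D)² = ∏ Det (D_k)². Finally, a
-- nonzero eigenvalue a of D_k makes t = 1 / a a zero of ρ (D²) t = ∏ (1 - t λ²), with λ
-- running over the eigenvalues of D, and so is positive; hence |Det D| = ∏ Det D_k.

open import Defs
open import Algebra.Bundles using (CommutativeRing; Semiring)
open import Algebra.Solver.Ring.AlmostCommutativeRing using (fromCommutativeRing; _-Raw-AlmostCommutative⟶_)
import Algebra.Solver.Ring as RingSolver
open import Data.Empty using (⊥; ⊥-elim)
open import Data.Fin.Base using (Fin; zero; suc; toℕ; punchIn; splitAt; _↑ˡ_; _↑ʳ_)
import Data.Fin.Properties as Fin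
open import Data.Integer.Base as ℤ using (ℤ; +_; -[1+_])
import Data.Integer.Properties as ℤ
open import Data.List.Base
  using (List; []; _∷_; _++_; [_]; _∷ʳ_; allFin; concatMap; filter; foldr; length; lookup; map; removeAt; tabulate; upTo)
open import Data.List.Extrema.Nat using (v<max⁺)
open import Data.List.Membership.Propositional using (_∈_)
open import Data.List.Membership.Propositional.Properties
  using (∈-lookup; ∈-map⁻; ∈-map⁺; ∈-++⁻; ∈-++⁺ˡ; ∈-++⁺ʳ; ∈-filter⁻; ∈-filter⁺; ∈-upTo⁺; ∈-upTo⁻; ∈-concatMap⁻)
open import Data.List.Properties
  using (≡-dec; ∷-injectiveʳ; ++-identityʳ; length-tabulate; length-removeAt′; filter-++; filter-accept; filter-reject; upTo-∷ʳ)
open import Data.List.Relation.Unary.All as All using (All; []; _∷_)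
open import Data.List.Relation.Unary.All.Properties using (++⁻ˡ)
open import Data.List.Relation.Unary.AllPairs as AllPairs using (AllPairs; []; _∷_; allPairs?)
open import Data.List.Relation.Unary.Any as Any using (here; there)
open import Data.List.Relation.Unary.Unique.Propositional using (Unique)
import Data.List.Relation.Unary.Unique.Propositional.Properties as Unique
open import Data.Maybe.Base using (Maybe; just; nothing)
open import Data.Nat.Base as ℕ using (ℕ; zero; suc; z≤n; s≤s)
open import Data.Nat.Divisibility using (_∣_; _∣?_; _∣0; ∣-refl; ∣m∣n⇒∣m+n; ∣m+n∣m⇒∣n; ∣1⇒≡1)
import Data.Nat.Properties as ℕ
open import Data.Product.Base using (∃; _×_; _,_; proj₁; proj₂)
open import Data.Sum.Base using (_⊎_; inj₁; inj₂; [_,_]′)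
open import Data.Vec.Functional using (head; tail; insertAt; updateAt) renaming (_∷_ to _▹_)
open import Data.Vec.Functional.Properties using (updateAt-updates; updateAt-minimal)
open import Function.Base using (_∘_; const; id; case_of_)
open import Level using (Level; _⊔_)
open import Relation.Binary.PropositionalEquality as ≡ using (_≡_; _≢_)
open import Relation.Binary.Structures using (IsStrictPartialOrder)
open import Relation.Nullary.Decidable using (yes; no; ¬?)
open import Relation.Nullary.Negation using (¬_)
open import Relation.Unary using (Pred; Decidable)

-- Polynomials occur only as functions, over a field whose equality and order are not assumed
-- decidable: coefficients cannot be extracted and degrees cannot be found by testing. Polynomial
-- identities are therefore proved at sufficiently many points with provably invertible differences.
-- These points are nonzero, because a `Spectrum` gives access to ρ only at invertible arguments,
-- and they are squares, because the factorisation of ρ (D²) is available only at arguments y². A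
-- leading coefficient is reached as a value at 0, after the substitution of 1 / x.
--
-- Spectra are given for `D`, the `D[ k ]` and the `L[ k ]`, but not for D² or d d*; these enter
-- through ρ alone. No eigenvectors are available either, which is why positivity has to come from a
-- factorisation and not from an inner product.
--
-- Finally, `d` is indexed by all simplices at once and is not literally a block matrix. Splitting d
-- d* into summands of full size, one for each dimension, avoids any reindexing, and ρ is
-- insensitive to the difference in size between such a summand and `D[ k ]`.

module IntegerSolver {c ℓ} (R : CommutativeRing c ℓ) where
  open CommutativeRing R
  open import Algebra.Properties.Ring ring
  open import Algebra.Properties.Semiring.Mult.TCOptimised semiring renaming (_×_ to _×ᴿ_)
  open import Relation.Binary.Reasoning.Setoid setoid

  -- The optimised multiple sends `+ 1` to `1#` by computation. Hence `con (+ 1)` stands for `1#`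
  -- itself in the calls of the solver.
  ⟦_⟧ℤ : ℤ → Carrier
  ⟦ + n ⟧ℤ = n ×ᴿ 1#
  ⟦ -[1+ n ] ⟧ℤ = - (suc n ×ᴿ 1#)

  ⊖-homo : ∀ m n → ⟦ m ℤ.⊖ n ⟧ℤ ≈ m ×ᴿ 1# - n ×ᴿ 1#
  ⊖-homo m zero = sym (trans (+-congˡ -0#≈0#) (+-identityʳ _))
  ⊖-homo zero (suc n) = sym (+-identityˡ _)
  ⊖-homo (suc m) (suc n) = begin
    ⟦ suc m ℤ.⊖ suc n ⟧ℤ              ≡⟨ ≡.cong ⟦_⟧ℤ (ℤ.[1+m]⊖[1+n]≡m⊖n m n) ⟩
    ⟦ m ℤ.⊖ n ⟧ℤ                      ≈⟨ ⊖-homo m n ⟩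
    m ×ᴿ 1# - n ×ᴿ 1#                   ≈⟨ +-congʳ (+-identityˡ _) ⟨
    0# + m ×ᴿ 1# - n ×ᴿ 1#              ≈⟨ +-congʳ (+-congʳ (-‿inverseʳ 1#)) ⟨
    1# - 1# + m ×ᴿ 1# - n ×ᴿ 1#         ≈⟨ +-congʳ (+-assoc _ _ _) ⟩
    1# + (- 1# + m ×ᴿ 1#) - n ×ᴿ 1#     ≈⟨ +-congʳ (+-congˡ (+-comm _ _)) ⟩
    1# + (m ×ᴿ 1# - 1#) - n ×ᴿ 1#       ≈⟨ +-congʳ (+-assoc _ _ _) ⟨
    1# + m ×ᴿ 1# - 1# - n ×ᴿ 1#         ≈⟨ +-assoc _ _ _ ⟩
    1# + m ×ᴿ 1# + (- 1# - n ×ᴿ 1#)     ≈⟨ +-congˡ (-‿+-comm _ _) ⟩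
    1# + m ×ᴿ 1# - (1# + n ×ᴿ 1#)       ≈⟨ +-cong (1+× m 1#) (-‿cong (1+× n 1#)) ⟨
    suc m ×ᴿ 1# - suc n ×ᴿ 1#           ∎

  +-homo : ∀ i j → ⟦ i ℤ.+ j ⟧ℤ ≈ ⟦ i ⟧ℤ + ⟦ j ⟧ℤ
  +-homo (+ m) (+ n) = ×-homo-+ 1# m n
  +-homo (+ m) -[1+ n ] = ⊖-homo m (suc n)
  +-homo -[1+ m ] (+ n) = trans (⊖-homo n (suc m)) (+-comm _ _)
  +-homo -[1+ m ] -[1+ n ] = begin
    - (suc (suc (m ℕ.+ n)) ×ᴿ 1#)       ≡⟨ ≡.cong (λ k → - (suc k ×ᴿ 1#)) (ℕ.+-suc m n) ⟨
    - ((suc m ℕ.+ suc n) ×ᴿ 1#)         ≈⟨ -‿cong (×-homo-+ 1# (suc m) (suc n)) ⟩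
    - (suc m ×ᴿ 1# + suc n ×ᴿ 1#)        ≈⟨ -‿+-comm _ _ ⟨
    - (suc m ×ᴿ 1#) - suc n ×ᴿ 1#        ∎

  -‿homo : ∀ i → ⟦ ℤ.- i ⟧ℤ ≈ - ⟦ i ⟧ℤ
  -‿homo (+ zero) = sym -0#≈0#
  -‿homo (+ suc n) = refl
  -‿homo -[1+ n ] = sym (-‿involutive _)

  *-homoˡ : ∀ m j → ⟦ + m ℤ.* j ⟧ℤ ≈ m ×ᴿ 1# * ⟦ j ⟧ℤ
  *-homoˡ m (+ n) = trans (reflexive (≡.cong ⟦_⟧ℤ (≡.sym (ℤ.pos-* m n)))) (×1-homo-* m n)
  *-homoˡ m -[1+ n ] = begin
    ⟦ + m ℤ.* -[1+ n ] ⟧ℤ              ≡⟨ ≡.cong ⟦_⟧ℤ (ℤ.neg-distribʳ-* (+ m) (+ suc n)) ⟨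
    ⟦ ℤ.- (+ m ℤ.* + suc n) ⟧ℤ         ≈⟨ -‿homo (+ m ℤ.* + suc n) ⟩
    - ⟦ + m ℤ.* + suc n ⟧ℤ             ≈⟨ -‿cong (*-homoˡ m (+ suc n)) ⟩
    - (m ×ᴿ 1# * (suc n ×ᴿ 1#))          ≈⟨ -‿distribʳ-* _ _ ⟩
    m ×ᴿ 1# * - (suc n ×ᴿ 1#)            ∎

  *-homo : ∀ i j → ⟦ i ℤ.* j ⟧ℤ ≈ ⟦ i ⟧ℤ * ⟦ j ⟧ℤ
  *-homo (+ m) j = *-homoˡ m j
  *-homo -[1+ m ] j = begin
    ⟦ -[1+ m ] ℤ.* j ⟧ℤ                ≡⟨ ≡.cong ⟦_⟧ℤ (ℤ.neg-distribˡ-* (+ suc m) j) ⟨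
    ⟦ ℤ.- (+ suc m ℤ.* j) ⟧ℤ           ≈⟨ -‿homo (+ suc m ℤ.* j) ⟩
    - ⟦ + suc m ℤ.* j ⟧ℤ               ≈⟨ -‿cong (*-homoˡ (suc m) j) ⟩
    - (suc m ×ᴿ 1# * ⟦ j ⟧ℤ)            ≈⟨ -‿distribˡ-* _ _ ⟩
    - (suc m ×ᴿ 1#) * ⟦ j ⟧ℤ            ∎

  homomorphism : ℤ.+-*-rawRing -Raw-AlmostCommutative⟶ fromCommutativeRing R
  homomorphism = record
    { ⟦_⟧ = ⟦_⟧ℤ ; +-homo = +-homo ; *-homo = *-homo ; -‿homo = -‿homo
    ; 0-homo = refl ; 1-homo = refl }

  -- Coefficients are compared as integers, since equality in `R` need not be decidable. Distinct
  -- integers count as undetermined: they may still agree in `R`.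
  _coeff≟_ : ∀ i j → Maybe (⟦ i ⟧ℤ ≈ ⟦ j ⟧ℤ)
  i coeff≟ j with i ℤ.≟ j
  ... | yes i≡j = just (reflexive (≡.cong ⟦_⟧ℤ i≡j))
  ... | no  _   = nothing

  open RingSolver ℤ.+-*-rawRing (fromCommutativeRing R) homomorphism _coeff≟_ public
    using (solve; _:=_; _:+_; _:*_; :-_; _:-_; con)

-- Finite sums, and functions that are linear or alternating in the rows of a matrix.

module Determinants {c ℓ₁ ℓ₂ ℓ₃} (K : OrderedField c ℓ₁ ℓ₂ ℓ₃) where
  open OrderedField K hiding (zero)
  open LinearAlgebra K
  open CommutativeRing commutativeRing using (ring; semiring)
  open import Algebra.Properties.Ring ring
  open import Algebra.Properties.Semiring.Sum semiring
    using (sum; sum-cong-≋; sum-replicate-zero; ∑-distrib-+; *-distribˡ-sum; *-distribʳ-sum)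
  open import Relation.Binary.Reasoning.Setoid setoid
  open IntegerSolver commutativeRing
  open import Algebra.Definitions.RawSemiring (Semiring.rawSemiring semiring) using () renaming (_^_ to _^ᴷ_)

  private variable
    m n : ℕ

  sum-zero : ∀ {n} {u : Fin n → Carrier} → (∀ i → u i ≈ 0#) → sum u ≈ 0#
  sum-zero {n} u≈0 = trans (sum-cong-≋ u≈0) (sum-replicate-zero n)

  sum-linear : ∀ {n} a b {u v w : Fin n → Carrier} → (∀ i → w i ≈ a * u i + b * v i) →
               sum w ≈ a * sum u + b * sum v
  sum-linear {n} a b {u} {v} w≈ = trans (sum-cong-≋ {n} w≈) (trans (∑-distrib-+ {n} (λ i → a * u i) (λ i → b * v i))
    (+-cong (sym (*-distribˡ-sum a u)) (sym (*-distribˡ-sum b v))))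

  sum-↑ : ∀ m {n} (u : Fin (m ℕ.+ n) → Carrier) →
          sum u ≈ sum (λ i → u (i ↑ˡ n)) + sum (λ i → u (m ↑ʳ i))
  sum-↑ zero u = sym (+-identityˡ _)
  sum-↑ (suc m) u = trans (+-congˡ (sum-↑ m (u ∘ suc))) (sym (+-assoc _ _ _))

  Row : ℕ → Set c
  Row n = Fin n → Carrier

  infix 4 _≋_ _≋ᴹ_

  _≋_ : Row n → Row n → Set ℓ₁
  u ≋ v = ∀ j → u j ≈ v j

  _≋ᴹ_ : Matrix m n → Matrix m n → Set ℓ₁
  M ≋ᴹ N = ∀ i → M i ≋ N i

  -- Recursion on both indices, in contrast to the decision made in `scalar`, lets entries and rows
  -- reduce in inductions on the size. `δ-scalar` is the bridge to `charPoly`.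
  δ : Matrix n n
  δ zero    zero    = 1#
  δ zero    (suc j) = 0#
  δ (suc i) zero    = 0#
  δ (suc i) (suc j) = δ i j

  δ-sym : ∀ {n} (i j : Fin n) → δ i j ≡ δ j i
  δ-sym zero    zero    = ≡.refl
  δ-sym zero    (suc j) = ≡.refl
  δ-sym (suc i) zero    = ≡.refl
  δ-sym (suc i) (suc j) = δ-sym i j

  δ-diag : ∀ {n} (i : Fin n) → δ i i ≡ 1#
  δ-diag zero    = ≡.refl
  δ-diag (suc i) = δ-diag i

  δ-punchIn : ∀ {n} (j : Fin (suc n)) k → δ j (punchIn j k) ≡ 0#
  δ-punchIn zero    k       = ≡.refl
  δ-punchIn (suc j) zero    = ≡.refl
  δ-punchIn (suc j) (suc k) = δ-punchIn j k

  δ-scalar : ∀ {n} x (i j : Fin n) → scalar x i j ≈ x * δ i j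
  δ-scalar x zero    zero    = sym (*-identityʳ x)
  δ-scalar x zero    (suc j) = sym (zeroʳ x)
  δ-scalar x (suc i) zero    = sym (zeroʳ x)
  δ-scalar x (suc i) (suc j) = trans (reflexive scalar-suc) (δ-scalar x i j)
    where
    scalar-suc : scalar x (suc i) (suc j) ≡ scalar x i j
    scalar-suc with i Fin.≟ j
    ... | yes _ = ≡.refl
    ... | no  _ = ≡.refl

  sum-δˡ : ∀ {n} (i : Fin n) (u : Row n) → sum (λ k → δ i k * u k) ≈ u i
  sum-δˡ zero u = begin
    1# * u zero + sum (λ k → 0# * u (suc k))  ≈⟨ +-cong (*-identityˡ _) (sum-zero λ k → zeroˡ (u (suc k))) ⟩
    u zero + 0#                               ≈⟨ +-identityʳ _ ⟩
    u zero                                    ∎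
  sum-δˡ (suc i) u = trans (+-cong (zeroˡ _) (sum-δˡ i (u ∘ suc))) (+-identityˡ _)

  sum-δʳ : ∀ {n} (u : Row n) (j : Fin n) → sum (λ k → u k * δ k j) ≈ u j
  sum-δʳ u j = trans (sum-cong-≋ λ k → trans (*-comm _ _) (*-congʳ (reflexive (δ-sym k j)))) (sum-δˡ j u)

  -- As `w` is a combination only up to pointwise `≈`, the single field also contains congruence of
  -- `G`: take `a = 1#` and `b = 0#`.
  record Linear {n} (G : Row n → Carrier) : Set (c ⊔ ℓ₁) where
    field
      linear : ∀ {u v w} a b → (∀ j → w j ≈ a * u j + b * v j) → G w ≈ a * G u + b * G v

  -- Here congruence is a field of its own, because for `m = 0` there is no row to which `linear`
  -- could be applied. Asking that three matrices agree off row `i`, in place of updating one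
  -- matrix, leaves their shape free.
  record Multilinear {m n} (F : Matrix m n → Carrier) : Set (c ⊔ ℓ₁) where
    field
      ≋-cong : ∀ {M N} → M ≋ᴹ N → F M ≈ F N
      linear : ∀ i {M N P} a b →
               (∀ k → k ≢ i → P k ≋ M k) → (∀ k → k ≢ i → P k ≋ N k) →
               (∀ j → P i j ≈ a * M i j + b * N i j) →
               F P ≈ a * F M + b * F N

  record Alternating {m n} (F : Matrix m n → Carrier) : Set (c ⊔ ℓ₁) where
    field
      multilinear : Multilinear F
      alternating : ∀ {i i′} M → i ≢ i′ → M i ≋ M i′ → F M ≈ 0#
    open Multilinear multilinear public

  Linear-expand : ∀ {n} {G : Row n → Carrier} → Linear G → ∀ v → G v ≈ sum (λ j → v j * G (δ j))
  -- On rows of length zero every row is a combination of any two others, so the coefficients `0#`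
  -- show that `G v` vanishes.
  Linear-expand {zero} G-lin v = trans (Linear.linear G-lin {v} {v} {v} 0# 0# λ ())
    (trans (+-cong (zeroˡ _) (zeroˡ _)) (+-identityˡ _))
  Linear-expand {suc n} {G} G-lin v = begin
    G v                                              ≈⟨ linear {u = δ zero} {v = 0# ▹ tail v} (v zero) 1# decompose ⟩
    v zero * G (δ zero) + 1# * G (0# ▹ tail v)       ≈⟨ +-congˡ (*-identityˡ _) ⟩
    v zero * G (δ zero) + G (0# ▹ tail v)            ≈⟨ +-congˡ (Linear-expand G′-lin (tail v)) ⟩
    v zero * G (δ zero) + sum (λ j → v (suc j) * G (0# ▹ δ j)) ≈⟨ +-congˡ (sum-cong-≋ λ j → *-congˡ (G-cong (0▹δ j))) ⟩
    v zero * G (δ zero) + sum (λ j → v (suc j) * G (δ (suc j))) ∎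
    where
    open Linear G-lin
    decompose : ∀ j → v j ≈ v zero * δ zero j + 1# * (0# ▹ tail v) j
    decompose zero    = solve 1 (λ x → x := x :* con (+ 1) :+ con (+ 1) :* con (+ 0)) refl (v zero)
    decompose (suc j) = solve 2 (λ x y → y := x :* con (+ 0) :+ con (+ 1) :* y) refl (v zero) (v (suc j))
    G-cong : ∀ {u w} → w ≋ u → G w ≈ G u
    G-cong {u} {w} w≋u = begin
      G w                 ≈⟨ linear {u = u} {v = u} 1# 0# (λ j → trans (w≋u j) (sym (trans (+-cong (*-identityˡ _) (zeroˡ _)) (+-identityʳ _)))) ⟩
      1# * G u + 0# * G u ≈⟨ +-cong (*-identityˡ _) (zeroˡ _) ⟩
      G u + 0#            ≈⟨ +-identityʳ _ ⟩
      G u                 ∎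
    0▹δ : ∀ j → (0# ▹ δ j) ≋ δ (suc j)
    0▹δ j zero    = refl
    0▹δ j (suc k) = refl
    G′-lin : Linear (λ w → G (0# ▹ w))
    G′-lin = record { linear = λ a b w≈ → linear a b λ where
      zero    → sym (trans (+-cong (zeroʳ a) (zeroʳ b)) (+-identityˡ _))
      (suc j) → w≈ j }

  ▹-η : ∀ {m n} (M : Matrix (suc m) n) → M ≋ᴹ (head M ▹ tail M)
  ▹-η M zero    j = refl
  ▹-η M (suc i) j = refl

  ▹-cong : ∀ {m n} {u v : Row n} {M N : Matrix m n} → u ≋ v → M ≋ᴹ N → (u ▹ M) ≋ᴹ (v ▹ N)
  ▹-cong u≋v M≋N zero    = u≋v
  ▹-cong u≋v M≋N (suc i) = M≋N i

  head-linear : ∀ {m n} {F : Matrix (suc m) n → Carrier} → Multilinear F → ∀ M → Linear (λ v → F (v ▹ M))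
  head-linear F-mul M = record { linear = λ a b w≈ → linear zero a b
    (λ { zero 0≢0 → ⊥-elim (0≢0 ≡.refl) ; (suc k) _ j → refl })
    (λ { zero 0≢0 → ⊥-elim (0≢0 ≡.refl) ; (suc k) _ j → refl }) w≈ }
    where open Multilinear F-mul

  tail-multilinear : ∀ {m n} {F : Matrix (suc m) n → Carrier} → Multilinear F → ∀ v → Multilinear (λ M → F (v ▹ M))
  tail-multilinear F-mul v = record
    { ≋-cong = λ M≋N → ≋-cong (▹-cong (λ j → refl) M≋N)
    ; linear = λ i a b P≋M P≋N Pi → linear (suc i) a b
        (λ { zero _ j → refl ; (suc k) k≢i → P≋M k (k≢i ∘ ≡.cong suc) })
        (λ { zero _ j → refl ; (suc k) k≢i → P≋N k (k≢i ∘ ≡.cong suc) }) Pi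
    }
    where open Multilinear F-mul

  -- Row operations, used to clear a column. In the application `v` sits above `M` as a further row
  -- of an alternating function, whence the assumption that a row `v` inside `M` gives zero. A
  -- finished row is absorbed into `F` before the next one is treated.
  subtract-multiples : ∀ {m n} {F : Matrix m n → Carrier} → Multilinear F → ∀ v →
    (∀ i M → M i ≋ v → F M ≈ 0#) → ∀ (a : Fin m → Carrier) M →
    F (λ i j → M i j - a i * v j) ≈ F M
  subtract-multiples {zero} F-mul v F-v a M = Multilinear.≋-cong F-mul λ ()
  subtract-multiples {suc m} {n} {F} F-mul v F-v a M = begin
    F M′                                              ≈⟨ ≋-cong (▹-η M′) ⟩
    F (head M′ ▹ tail M′)                             ≈⟨ Linear.linear (head-linear F-mul (tail M′)) {u = head M} {v = v} 1# (- a zero)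
                                                          (λ j → +-cong (sym (*-identityˡ _)) (-‿distribˡ-* _ _)) ⟩
    1# * F (head M ▹ tail M′) + - a zero * F (v ▹ tail M′) ≈⟨ +-cong (*-identityˡ _) (trans (*-congˡ (F-v zero _ λ j → refl)) (zeroʳ _)) ⟩
    F (head M ▹ tail M′) + 0#                         ≈⟨ +-identityʳ _ ⟩
    F (head M ▹ tail M′)                              ≈⟨ subtract-multiples (tail-multilinear F-mul (head M)) v
                                                          (λ i N Ni → F-v (suc i) _ Ni) (a ∘ suc) (tail M) ⟩
    F (head M ▹ tail M)                               ≈⟨ ≋-cong (▹-η M) ⟨
    F M                                               ∎
    where
    open Multilinear F-mul
    M′ : Matrix (suc m) n
    M′ i j = M i j - a i * v j

  -- Polarisation: with the sum of the two rows in both places `F` vanishes, and so do the two of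
  -- its four terms in which a row is repeated; the other two are therefore opposite.
  Alternating-swap : ∀ {m n} {F : Matrix m n → Carrier} → Alternating F → ∀ {i i′} M N → i ≢ i′ →
    N i ≋ M i′ → N i′ ≋ M i → (∀ k → k ≢ i → k ≢ i′ → N k ≋ M k) → F N ≈ - F M
  Alternating-swap {m} {n} {F} F-alt {i} {i′} M N i≢i′ Ni Ni′ Nk = begin
    F N                          ≈⟨ ≋-cong N≋ ⟩
    F (U b a)                    ≈⟨ +-identityʳ _ ⟨
    F (U b a) + 0#               ≈⟨ +-congˡ (-‿inverseʳ _) ⟨
    F (U b a) + (F (U a b) - F (U a b)) ≈⟨ +-assoc _ _ _ ⟨
    F (U b a) + F (U a b) - F (U a b) ≈⟨ +-congʳ sum≈0 ⟩
    0# - F (U a b)               ≈⟨ +-identityˡ _ ⟩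
    - F (U a b)                  ≈⟨ -‿cong (≋-cong M≋) ⟨
    - F M                        ∎
    where
    open Alternating F-alt
    a b s : Row n
    a = M i
    b = M i′
    s j = a j + b j
    U : Row n → Row n → Matrix m n
    U x y = updateAt (updateAt M i′ (const y)) i (const x)
    U-i : ∀ x y → U x y i ≡ x
    U-i x y = updateAt-updates i (updateAt M i′ (const y))
    U-i′ : ∀ x y → U x y i′ ≡ y
    U-i′ x y = ≡.trans (updateAt-minimal i′ i (updateAt M i′ (const y)) (i≢i′ ∘ ≡.sym)) (updateAt-updates i′ M)
    U-k : ∀ x y k → k ≢ i → k ≢ i′ → U x y k ≡ M k
    U-k x y k k≢i k≢i′ = ≡.trans (updateAt-minimal k i (updateAt M i′ (const y)) k≢i) (updateAt-minimal k i′ M k≢i′)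
    at : ∀ {x y : Row n} → x ≡ y → x ≋ y
    at ≡.refl j = refl
    split : ∀ (P : Fin m → Set ℓ₁) → P i → P i′ → (∀ k → k ≢ i → k ≢ i′ → P k) → ∀ k → P k
    split P Pi Pi′ Pk k with k Fin.≟ i | k Fin.≟ i′
    ... | yes ≡.refl | _          = Pi
    ... | no _       | yes ≡.refl = Pi′
    ... | no k≢i     | no k≢i′    = Pk k k≢i k≢i′
    U-unique : ∀ {x y} P → P i ≋ x → P i′ ≋ y → (∀ k → k ≢ i → k ≢ i′ → P k ≋ M k) → P ≋ᴹ U x y
    U-unique {x} {y} P Pi Pi′ Pk = split (λ k → P k ≋ U x y k)
      (λ j → trans (Pi j) (sym (at (U-i x y) j))) (λ j → trans (Pi′ j) (sym (at (U-i′ x y) j)))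
      (λ k k≢i k≢i′ j → trans (Pk k k≢i k≢i′ j) (sym (at (U-k x y k k≢i k≢i′) j)))
    N≋ : N ≋ᴹ U b a
    N≋ = U-unique N Ni Ni′ Nk
    M≋ : M ≋ᴹ U a b
    M≋ = U-unique M (λ j → refl) (λ j → refl) (λ k _ _ j → refl)
    1*+1* : ∀ x y → x + y ≈ 1# * x + 1# * y
    1*+1* x y = sym (+-cong (*-identityˡ x) (*-identityˡ y))
    addˡ : ∀ y → F (U s y) ≈ F (U a y) + F (U b y)
    addˡ y = trans (linear i {U a y} {U b y} {U s y} 1# 1#
      (off a) (off b)
      (λ j → trans (at (U-i s y) j) (trans (1*+1* _ _) (sym (+-cong (*-congˡ (at (U-i a y) j)) (*-congˡ (at (U-i b y) j)))))))
      (sym (1*+1* _ _))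
      where
      off : ∀ x k → k ≢ i → U s y k ≋ U x y k
      off x k k≢i = at (≡.trans (updateAt-minimal k i (updateAt M i′ (const y)) k≢i)
                       (≡.sym (updateAt-minimal k i (updateAt M i′ (const y)) k≢i)))
    addʳ : ∀ x → F (U x s) ≈ F (U x a) + F (U x b)
    addʳ x = trans (linear i′ {U x a} {U x b} {U x s} 1# 1#
      (λ k k≢i′ → off a k≢i′) (λ k k≢i′ → off b k≢i′)
      (λ j → trans (at (U-i′ x s) j) (trans (1*+1* _ _) (sym (+-cong (*-congˡ (at (U-i′ x a) j)) (*-congˡ (at (U-i′ x b) j)))))))
      (sym (1*+1* _ _))
      where
      off : ∀ y {k} → k ≢ i′ → U x s k ≋ U x y k
      off y {k} k≢i′ with k Fin.≟ i
      ... | yes ≡.refl = at (≡.trans (U-i x s) (≡.sym (U-i x y)))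
      ... | no k≢i     = at (≡.trans (U-k x s k k≢i k≢i′) (≡.sym (U-k x y k k≢i k≢i′)))
    diag : ∀ x → F (U x x) ≈ 0#
    diag x = alternating (U x x) i≢i′ (at (≡.trans (U-i x x) (≡.sym (U-i′ x x))))
    sum≈0 : F (U b a) + F (U a b) ≈ 0#
    sum≈0 = sym (begin
      0#                                                     ≈⟨ diag s ⟨
      F (U s s)                                              ≈⟨ addˡ s ⟩
      F (U a s) + F (U b s)                                  ≈⟨ +-cong (addʳ a) (addʳ b) ⟩
      F (U a a) + F (U a b) + (F (U b a) + F (U b b))        ≈⟨ +-cong (+-congʳ (diag a)) (+-congˡ (diag b)) ⟩
      0# + F (U a b) + (F (U b a) + 0#)                      ≈⟨ +-cong (+-identityˡ _) (+-identityʳ _) ⟩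
      F (U a b) + F (U b a)                                  ≈⟨ +-comm _ _ ⟩
      F (U b a) + F (U a b)                                  ∎)

  -- The Laplace expansion is multilinear and alternating.

  minor : ∀ {n} → Matrix (suc n) (suc n) → Fin (suc n) → Matrix n n
  minor M j i k = M (suc i) (punchIn j k)

  det-cong : ∀ {n} {M N : Matrix n n} → M ≋ᴹ N → det M ≈ det N
  det-cong {zero} M≋N = refl
  det-cong {suc n} M≋N = sum-cong-≋ λ j →
    *-congˡ { -1^ (toℕ j) } (*-cong (M≋N zero j) (det-cong λ i k → M≋N (suc i) (punchIn j k)))

  -- The maps φ of `double-expansion` list the columns that survive two deletions; this is the form
  -- of such a map when column 0 is among the survivors.
  lift : ∀ {m n} → (Fin m → Fin n) → Fin (suc m) → Fin (suc n)
  lift φ zero    = zero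
  lift φ (suc i) = suc (φ i)

  -- In the expansion of a determinant along two equal rows, the terms for the
  -- columns (0, k + 1) and (k + 1, 0) cancel; the others have the same shape with
  -- column 0 put aside.
  double-expansion : ∀ n (a : Row (suc (suc n))) (g : (Fin n → Fin (suc (suc n))) → Carrier) →
    (∀ φ ψ → (∀ i → φ i ≡ ψ i) → g φ ≈ g ψ) →
    sum (λ j → -1^ (toℕ j) * (a j * sum (λ k →
      -1^ (toℕ k) * (a (punchIn j k) * g (punchIn j ∘ punchIn k))))) ≈ 0#
  double-expansion n a g g-cong = begin
    sum (λ j → -1^ (toℕ j) * (a j * sum (s j)))
      ≈⟨ sum-cong-≋ pull-in ⟩
    sum (t zero) + sum (λ j → t (suc j) zero + sum (λ k → t (suc j) (suc k)))
      ≈⟨ +-congˡ (∑-distrib-+ (λ j → t (suc j) zero) (λ j → sum (λ k → t (suc j) (suc k)))) ⟩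
    sum (t zero) + (sum (λ j → t (suc j) zero) + sum (λ j → sum (λ k → t (suc j) (suc k))))
      ≈⟨ +-assoc _ _ _ ⟨
    sum (t zero) + sum (λ j → t (suc j) zero) + sum (λ j → sum (λ k → t (suc j) (suc k)))
      ≈⟨ +-cong (sym (∑-distrib-+ (t zero) (λ j → t (suc j) zero))) (inner n a g g-cong) ⟩
    sum (λ k → t zero k + t (suc k) zero) + 0#
      ≈⟨ +-identityʳ _ ⟩
    sum (λ k → t zero k + t (suc k) zero)
      ≈⟨ sum-zero cancel ⟩
    0# ∎
    where
    s t : Matrix (suc (suc n)) (suc n)
    s j k = -1^ (toℕ k) * (a (punchIn j k) * g (punchIn j ∘ punchIn k))
    t j k = -1^ (toℕ j) * (a j * s j k)
    pull-in : ∀ j → -1^ (toℕ j) * (a j * sum (s j)) ≈ sum (t j)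
    pull-in j = trans (*-congˡ (*-distribˡ-sum (a j) (s j))) (*-distribˡ-sum (-1^ (toℕ j)) (λ k → a j * s j k))
    cancel : ∀ k → t zero k + t (suc k) zero ≈ 0#
    cancel k = solve 4 (λ a₀ aₖ e g → con (+ 1) :* (a₀ :* (e :* (aₖ :* g))) :+
                                      (:- con (+ 1) :* e) :* (aₖ :* (con (+ 1) :* (a₀ :* g))) := con (+ 0))
                 refl (a zero) (a (suc k)) (-1^ (toℕ k)) (g (suc ∘ punchIn k))
    inner : ∀ n (a : Row (suc (suc n))) (g : (Fin n → Fin (suc (suc n))) → Carrier) →
      (∀ φ ψ → (∀ i → φ i ≡ ψ i) → g φ ≈ g ψ) →
      sum {suc n} (λ j → sum {n} (λ k → -1^ (toℕ (suc j)) * (a (suc j) * (-1^ (toℕ (suc k)) *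
        (a (punchIn (suc j) (suc k)) * g (punchIn (suc j) ∘ punchIn (suc k))))))) ≈ 0#
    inner zero a g g-cong = +-identityʳ 0#
    inner (suc n) a g g-cong = trans
      (sum-cong-≋ λ j → trans (sum-cong-≋ λ k → trans
        (solve 5 (λ e aⱼ f aₖ g → (:- con (+ 1) :* e) :* (aⱼ :* ((:- con (+ 1) :* f) :* (aₖ :* g))) :=
                                  e :* (aⱼ :* (f :* (aₖ :* g)))) refl
          (-1^ (toℕ j)) (a (suc j)) (-1^ (toℕ k)) (a (suc (punchIn j k))) (g (punchIn (suc j) ∘ punchIn (suc k))))
        (*-congˡ (*-congˡ (*-congˡ (*-congˡ (g-cong _ (lift (punchIn j ∘ punchIn k)) λ { zero → ≡.refl ; (suc i) → ≡.refl }))))))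
        (sym (trans (*-congˡ (*-distribˡ-sum (a (suc j)) (s′ j))) (*-distribˡ-sum (-1^ (toℕ j)) (λ k → a (suc j) * s′ j k)))))
      (double-expansion n (tail a) (g ∘ lift) λ φ ψ φ≗ψ → g-cong (lift φ) (lift ψ) λ { zero → ≡.refl ; (suc i) → ≡.cong suc (φ≗ψ i) })
      where
      s′ : Matrix (suc (suc n)) (suc n)
      s′ j k = -1^ (toℕ k) * (a (suc (punchIn j k)) * g (lift (punchIn j ∘ punchIn k)))

  det-linear : ∀ n i {M N P : Matrix n n} a b →
        (∀ k → k ≢ i → P k ≋ M k) → (∀ k → k ≢ i → P k ≋ N k) →
        (∀ j → P i j ≈ a * M i j + b * N i j) → det P ≈ a * det M + b * det N
  det-linear (suc n) zero {M} {N} {P} a b P≋M P≋N P₀ = sum-linear {suc n} a b λ j → begin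
    -1^ (toℕ j) * (P zero j * det (minor P j))
      ≈⟨ *-congˡ (*-congʳ (P₀ j)) ⟩
    -1^ (toℕ j) * ((a * M zero j + b * N zero j) * det (minor P j))
      ≈⟨ solve 6 (λ e a b x y d → e :* ((a :* x :+ b :* y) :* d) := a :* (e :* (x :* d)) :+ b :* (e :* (y :* d)))
           refl (-1^ (toℕ j)) a b (M zero j) (N zero j) (det (minor P j)) ⟩
    a * (-1^ (toℕ j) * (M zero j * det (minor P j))) + b * (-1^ (toℕ j) * (N zero j * det (minor P j)))
      ≈⟨ +-cong (*-congˡ (*-congˡ (*-congˡ (det-cong λ i k → P≋M (suc i) (λ ()) (punchIn j k)))))
                (*-congˡ (*-congˡ (*-congˡ (det-cong λ i k → P≋N (suc i) (λ ()) (punchIn j k))))) ⟩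
    a * (-1^ (toℕ j) * (M zero j * det (minor M j))) + b * (-1^ (toℕ j) * (N zero j * det (minor N j))) ∎
  det-linear (suc n) (suc i) {M} {N} {P} a b P≋M P≋N Pi = sum-linear {suc n} a b λ j → begin
    -1^ (toℕ j) * (P zero j * det (minor P j))
      ≈⟨ *-congˡ (*-congˡ (det-linear n i a b (λ k k≢i l → P≋M (suc k) (k≢i ∘ Fin.suc-injective) (punchIn j l))
                                        (λ k k≢i l → P≋N (suc k) (k≢i ∘ Fin.suc-injective) (punchIn j l))
                                        (λ l → Pi (punchIn j l)))) ⟩
    -1^ (toℕ j) * (P zero j * (a * det (minor M j) + b * det (minor N j)))
      ≈⟨ solve 6 (λ e a b x y z → e :* (x :* (a :* y :+ b :* z)) := a :* (e :* (x :* y)) :+ b :* (e :* (x :* z)))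
           refl (-1^ (toℕ j)) a b (P zero j) (det (minor M j)) (det (minor N j)) ⟩
    a * (-1^ (toℕ j) * (P zero j * det (minor M j))) + b * (-1^ (toℕ j) * (P zero j * det (minor N j)))
      ≈⟨ +-cong (*-congˡ (*-congˡ (*-congʳ (P≋M zero (λ ()) j)))) (*-congˡ (*-congˡ (*-congʳ (P≋N zero (λ ()) j)))) ⟩
    a * (-1^ (toℕ j) * (M zero j * det (minor M j))) + b * (-1^ (toℕ j) * (N zero j * det (minor N j))) ∎

  det-multilinear : ∀ n → Multilinear (det {n})
  det-multilinear n = record { ≋-cong = det-cong ; linear = det-linear n }

  -- Alternation one size down allows two rows below the top one to be swapped inside all minors, at
  -- the cost of a sign. This moves the repeated row directly below the top, where
  -- `double-expansion` applies.
  det-equal-rows₀ : ∀ n → Alternating (det {n}) → ∀ i′ (M : Matrix (suc n) (suc n)) → M zero ≋ M (suc i′) → det M ≈ 0#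
  det-equal-rows₀ (suc n) _ zero M M₀≋M₁ = trans
    (sum-cong-≋ λ j → *-congˡ { -1^ (toℕ j) } (*-congˡ {M zero j} (sum-cong-≋ λ k →
      *-congˡ { -1^ (toℕ k) } (*-congʳ {det (λ i l → M (suc (suc i)) (punchIn j (punchIn k l)))} (sym (M₀≋M₁ (punchIn j k)))))))
    (double-expansion n (M zero) (λ φ → det (λ i k → M (suc (suc i)) (φ k)))
      λ φ ψ φ≗ψ → det-cong λ i k → reflexive (≡.cong (M (suc (suc i))) (φ≗ψ k)))
  det-equal-rows₀ (suc n) alt (suc i′) M M₀≋Mᵢ = begin
    det M                                                        ≈⟨ sum-cong-≋ (λ j → trans
                                                                      (*-congˡ (*-congˡ (minor-swap j)))
                                                                      (solve 3 (λ e x d → e :* (x :* :- d) := :- con (+ 1) :* (e :* (x :* d))) refl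
                                                                        (-1^ (toℕ j)) (M zero j) (det (minor N j)))) ⟩
    sum (λ j → - 1# * (-1^ (toℕ j) * (N zero j * det (minor N j)))) ≈⟨ *-distribˡ-sum (- 1#) (λ j → -1^ (toℕ j) * (N zero j * det (minor N j))) ⟨
    - 1# * det N                                                 ≈⟨ *-congˡ (det-equal-rows₀ (suc n) alt zero N M₀≋Mᵢ) ⟩
    - 1# * 0#                                                    ≈⟨ zeroʳ _ ⟩
    0#                                                           ∎
    where
    N : Matrix (suc (suc n)) (suc (suc n))
    N = M zero ▹ (M (suc (suc i′)) ▹ updateAt (tail (tail M)) i′ (const (M (suc zero))))
    minor-swap : ∀ j → det (minor M j) ≈ - det (minor N j)
    minor-swap j = Alternating-swap alt {zero} {suc i′} (minor N j) (minor M j) (λ ())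
      (λ k → reflexive (≡.cong (λ r → r (punchIn j k)) (≡.sym (updateAt-updates i′ (tail (tail M))))))
      (λ k → refl)
      λ { zero 0≢0 _ → ⊥-elim (0≢0 ≡.refl)
        ; (suc k) _ k≢i′ l → reflexive (≡.cong (λ r → r (punchIn j l))
            (≡.sym (updateAt-minimal k i′ (tail (tail M)) (k≢i′ ∘ ≡.cong suc)))) }

  det-alternating : ∀ n → Alternating (det {n})
  det-alternating zero = record { multilinear = det-multilinear zero ; alternating = λ { {()} } }
  det-alternating (suc n) = record { multilinear = det-multilinear (suc n) ; alternating = equal-rows }
    where
    equal-rows : ∀ {i i′} (M : Matrix (suc n) (suc n)) → i ≢ i′ → M i ≋ M i′ → det M ≈ 0#
    equal-rows {zero}  {zero}   M 0≢0 _ = ⊥-elim (0≢0 ≡.refl)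
    equal-rows {zero}  {suc i′} M _ M≋ = det-equal-rows₀ n (det-alternating n) i′ M M≋
    equal-rows {suc i} {zero}   M _ M≋ = det-equal-rows₀ n (det-alternating n) i M (λ j → sym (M≋ j))
    equal-rows {suc i} {suc i′} M i≢i′ M≋ = sum-zero λ j → trans (*-congˡ { -1^ (toℕ j) } (trans (*-congˡ {M zero j}
      (Alternating.alternating (det-alternating n) (minor M j) (i≢i′ ∘ ≡.cong suc) (λ k → M≋ (punchIn j k)))) (zeroʳ _))) (zeroʳ _)

  -- Uniqueness of the alternating form, and multiplicativity of the determinant.

  insertZero : ∀ {n} → Fin (suc n) → Row n → Row (suc n)
  insertZero j u = insertAt u j 0#

  insertZero-linear : ∀ {n} (l : Fin (suc n)) {u v w : Row n} a b → (∀ j → w j ≈ a * u j + b * v j) →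
    ∀ j → insertZero l w j ≈ a * insertZero l u j + b * insertZero l v j
  insertZero-linear zero a b w≈ zero = sym (trans (+-cong (zeroʳ a) (zeroʳ b)) (+-identityˡ _))
  insertZero-linear zero a b w≈ (suc j) = w≈ j
  insertZero-linear {suc n} (suc l) a b w≈ zero = w≈ zero
  insertZero-linear {suc n} (suc l) a b w≈ (suc j) = insertZero-linear l a b (w≈ ∘ suc) j

  insertZero-cong : ∀ {n} (l : Fin (suc n)) {u v : Row n} → u ≋ v → insertZero l u ≋ insertZero l v
  insertZero-cong zero u≋v zero = refl
  insertZero-cong zero u≋v (suc j) = u≋v j
  insertZero-cong {suc n} (suc l) u≋v zero = u≋v zero
  insertZero-cong {suc n} (suc l) u≋v (suc j) = insertZero-cong l (u≋v ∘ suc) j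

  insertZero-0 : ∀ {n} (l : Fin (suc n)) j → insertZero {n} l (const 0#) j ≈ 0#
  insertZero-0 zero zero = refl
  insertZero-0 zero (suc j) = refl
  insertZero-0 {suc n} (suc l) zero = refl
  insertZero-0 {suc n} (suc l) (suc j) = insertZero-0 l j

  insertZero-punchIn : ∀ {n} (l : Fin (suc n)) (u : Row (suc n)) → u l ≈ 0# → u ≋ insertZero l (u ∘ punchIn l)
  insertZero-punchIn zero u ul≈0 zero = ul≈0
  insertZero-punchIn zero u ul≈0 (suc j) = refl
  insertZero-punchIn {suc n} (suc l) u ul≈0 zero = refl
  insertZero-punchIn {suc n} (suc l) u ul≈0 (suc j) = insertZero-punchIn l (tail u) ul≈0 j

  -- Fixing the top row to be a basis vector and column `j` to be zero elsewhere leaves an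
  -- alternating form of size one less; this is the passage to a minor for an abstract `F`.
  restrict : ∀ {n} {F : Matrix (suc n) (suc n) → Carrier} → Alternating F → ∀ j →
    Alternating (λ (M : Matrix n n) → F (δ j ▹ (insertZero j ∘ M)))
  restrict F-alt j = record
    { multilinear = record
      { ≋-cong = λ M≋N → Multilinear.≋-cong F-mul λ i → insertZero-cong j (M≋N i)
      ; linear = λ i a b P≋M P≋N Pi → Multilinear.linear F-mul i a b
          (λ k k≢i → insertZero-cong j (P≋M k k≢i)) (λ k k≢i → insertZero-cong j (P≋N k k≢i))
          (insertZero-linear j a b Pi)
      }
    ; alternating = λ M i≢i′ M≋ → alternating _ (i≢i′ ∘ Fin.suc-injective) (insertZero-cong j M≋)
    }
    where
    open Alternating F-alt
    F-mul = tail-multilinear multilinear (δ j)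

  -- The rows on the left are those of the identity with row `j` moved to the top, a cycle of length
  -- j + 1, which explains the sign. One swap brings row 0 back to the top and leaves the same
  -- question, with `j` lowered by one, for `restrict F-alt zero`.
  restrict-δ : ∀ {n} {F : Matrix (suc n) (suc n) → Carrier} → Alternating F → ∀ j →
    F (δ j ▹ (insertZero j ∘ δ)) ≈ -1^ (toℕ j) * F δ
  restrict-δ F-alt zero = trans (≋-cong λ
    { zero j → refl ; (suc i) zero → refl ; (suc i) (suc j) → refl }) (sym (*-identityˡ _))
    where open Alternating F-alt
  restrict-δ {suc n} {F} F-alt (suc j) = begin
    F (δ (suc j) ▹ (insertZero (suc j) ∘ δ))
      ≈⟨ Alternating-swap F-alt {zero} {suc zero} (δ zero ▹ (insertZero zero ∘ (δ j ▹ (insertZero j ∘ δ))))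
           (δ (suc j) ▹ (insertZero (suc j) ∘ δ)) (λ ()) row₀ row₁ rows ⟩
    - F (δ zero ▹ (insertZero zero ∘ (δ j ▹ (insertZero j ∘ δ))))
      ≈⟨ -‿cong (restrict-δ (restrict F-alt zero) j) ⟩
    - (-1^ (toℕ j) * F (δ zero ▹ (insertZero zero ∘ δ)))
      ≈⟨ -‿cong (*-congˡ (restrict-δ F-alt zero)) ⟩
    - (-1^ (toℕ j) * (1# * F δ))
      ≈⟨ solve 2 (λ e x → :- (e :* (con (+ 1) :* x)) := (:- con (+ 1) :* e) :* x) refl (-1^ (toℕ j)) (F δ) ⟩
    - 1# * -1^ (toℕ j) * F δ ∎
    where
    row₀ : δ (suc j) ≋ insertZero zero (δ j)
    row₀ zero    = refl
    row₀ (suc k) = refl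
    row₁ : insertZero (suc j) (δ zero) ≋ δ zero
    row₁ zero    = refl
    row₁ (suc k) = insertZero-0 j k
    rows : ∀ k → k ≢ zero → k ≢ suc zero →
      (δ (suc j) ▹ (insertZero (suc j) ∘ δ)) k ≋ (δ zero ▹ (insertZero zero ∘ (δ j ▹ (insertZero j ∘ δ)))) k
    rows zero          0≢0 _ = ⊥-elim (0≢0 ≡.refl)
    rows (suc zero)    _ 1≢1 = ⊥-elim (1≢1 ≡.refl)
    rows (suc (suc k)) _ _ zero    = refl
    rows (suc (suc k)) _ _ (suc l) = refl

  -- Expanding `F` in its top row, clearing column `j` from the rows below and using induction on
  -- the size reproduces the very Laplace expansion that defines `det`.
  alternating-unique : ∀ n {F : Matrix n n → Carrier} → Alternating F → ∀ M → F M ≈ det M * F δ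
  alternating-unique zero F-alt M = trans (Alternating.≋-cong F-alt λ ()) (sym (*-identityˡ _))
  alternating-unique (suc n) {F} F-alt M = begin
    F M
      ≈⟨ ≋-cong (▹-η M) ⟩
    F (head M ▹ tail M)
      ≈⟨ Linear-expand (head-linear multilinear (tail M)) (head M) ⟩
    sum (λ j → M zero j * F (δ j ▹ tail M))
      ≈⟨ sum-cong-≋ {suc n} (λ j → trans (*-congˡ (expand j))
           (solve 4 (λ x d e f → x :* (d :* (e :* f)) := (e :* (x :* d)) :* f) refl
             (M zero j) (det (minor M j)) (-1^ (toℕ j)) (F δ))) ⟩
    sum (λ j → (-1^ (toℕ j) * (M zero j * det (minor M j))) * F δ)
      ≈⟨ *-distribʳ-sum (F δ) (λ j → -1^ (toℕ j) * (M zero j * det (minor M j))) ⟨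
    det M * F δ ∎
    where
    open Alternating F-alt
    expand : ∀ j → F (δ j ▹ tail M) ≈ det (minor M j) * (-1^ (toℕ j) * F δ)
    expand j = begin
      F (δ j ▹ tail M)
        ≈⟨ subtract-multiples (tail-multilinear multilinear (δ j)) (δ j)
             (λ i N Ni → alternating {zero} {suc i} _ (λ ()) (λ k → sym (Ni k))) (λ i → M (suc i) j) (tail M) ⟨
      F (δ j ▹ cleared)
        ≈⟨ ≋-cong (▹-cong (λ k → refl) λ i k → trans
             (insertZero-punchIn j (cleared i) (cleared-j i) k) (insertZero-cong j (cleared-k i) k)) ⟩
      F (δ j ▹ (insertZero j ∘ minor M j))
        ≈⟨ alternating-unique n (restrict F-alt j) (minor M j) ⟩
      det (minor M j) * F (δ j ▹ (insertZero j ∘ δ))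
        ≈⟨ *-congˡ (restrict-δ F-alt j) ⟩
      det (minor M j) * (-1^ (toℕ j) * F δ) ∎
      where
      cleared : Matrix n (suc n)
      cleared i k = M (suc i) k - M (suc i) j * δ j k
      cleared-j : ∀ i → cleared i j ≈ 0#
      cleared-j i = trans (+-congˡ (-‿cong (trans (*-congˡ (reflexive (δ-diag j))) (*-identityʳ _)))) (-‿inverseʳ _)
      cleared-k : ∀ i k → cleared i (punchIn j k) ≈ minor M j i k
      cleared-k i k = trans (+-congˡ (trans (-‿cong (trans (*-congˡ (reflexive (δ-punchIn j k))) (zeroʳ _))) -0#≈0#)) (+-identityʳ _)

  ⊗-identityˡ : ∀ {m n} (M : Matrix m n) → (δ ⊗ M) ≋ᴹ M
  ⊗-identityˡ M i j = sum-δˡ i (λ k → M k j)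

  -- As a function of `M` alone the left side is alternating, and at the identity its value is
  -- `det N`; so `alternating-unique` applies.
  det-⊗ : ∀ {n} (M N : Matrix n n) → det (M ⊗ N) ≈ det M * det N
  det-⊗ {n} M N = trans (alternating-unique n F-alt M) (*-congˡ (det-cong (⊗-identityˡ N)))
    where
    open Alternating (det-alternating n)
    F-alt : Alternating (λ M → det (M ⊗ N))
    F-alt = record
      { multilinear = record
        { ≋-cong = λ M≋M′ → det-cong λ i j → sum-cong-≋ {n} λ k → *-congʳ (M≋M′ i k)
        ; linear = λ i a b P≋M P≋N Pi → linear i a b
            (λ k k≢i j → sum-cong-≋ {n} λ l → *-congʳ (P≋M k k≢i l))
            (λ k k≢i j → sum-cong-≋ {n} λ l → *-congʳ (P≋N k k≢i l))
            (λ j → sum-linear {n} a b λ l → trans (*-congʳ (Pi l))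
              (solve 5 (λ a b x y z → (a :* x :+ b :* y) :* z := a :* (x :* z) :+ b :* (y :* z)) refl a b _ _ (N l j)))
        }
      ; alternating = λ M i≢i′ M≋ → alternating _ i≢i′ λ j → sum-cong-≋ {n} λ l → *-congʳ (M≋ l)
      }

  det-δ : ∀ n → det (δ {n}) ≈ 1#
  det-δ zero    = refl
  det-δ (suc n) = trans (+-cong
    (trans (*-identityˡ _) (trans (*-identityˡ _) (det-δ n)))
    (sum-zero {n} λ j → trans (*-congˡ { -1^ (toℕ (suc j)) } (zeroˡ _)) (zeroʳ _))) (+-identityʳ _)

  det-* : ∀ {n} a (M : Matrix n n) → det (λ i j → a * M i j) ≈ a ^ᴷ n * det M
  det-* {zero}  a M = sym (*-identityˡ 1#)
  det-* {suc n} a M = begin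
    sum (λ j → -1^ (toℕ j) * (a * M zero j * det (λ i k → a * minor M j i k)))
      ≈⟨ sum-cong-≋ {suc n} (λ j → trans (*-congˡ (*-congˡ (det-* a (minor M j))))
           (solve 5 (λ e a x p d → e :* (a :* x :* (p :* d)) := (a :* p) :* (e :* (x :* d))) refl
             (-1^ (toℕ j)) a (M zero j) (a ^ᴷ n) (det (minor M j)))) ⟩
    sum (λ j → (a * a ^ᴷ n) * (-1^ (toℕ j) * (M zero j * det (minor M j))))
      ≈⟨ *-distribˡ-sum (a * a ^ᴷ n) (λ j → -1^ (toℕ j) * (M zero j * det (minor M j))) ⟨
    a * a ^ᴷ n * det M ∎

  -- Block triangular determinants and Sylvester's identity.

  punchIn-↑ˡ-↑ˡ : ∀ {m} n (j : Fin (suc m)) k → punchIn (j ↑ˡ n) (k ↑ˡ n) ≡ punchIn j k ↑ˡ n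
  punchIn-↑ˡ-↑ˡ n zero    k       = ≡.refl
  punchIn-↑ˡ-↑ˡ n (suc j) zero    = ≡.refl
  punchIn-↑ˡ-↑ˡ n (suc j) (suc k) = ≡.cong suc (punchIn-↑ˡ-↑ˡ n j k)

  punchIn-↑ˡ-↑ʳ : ∀ m n (j : Fin (suc m)) (k : Fin n) → punchIn (j ↑ˡ n) (m ↑ʳ k) ≡ suc m ↑ʳ k
  punchIn-↑ˡ-↑ʳ m       n zero    k = ≡.refl
  punchIn-↑ˡ-↑ʳ (suc m) n (suc j) k = ≡.cong suc (punchIn-↑ˡ-↑ʳ m n j k)

  -- The top row is supported on the left columns, and deleting it together with one of these leaves
  -- a matrix of the same shape with the same lower right block.
  det-lower : ∀ m {n} (M : Matrix (m ℕ.+ n) (m ℕ.+ n)) → (∀ i j → M (i ↑ˡ n) (m ↑ʳ j) ≈ 0#) →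
    det M ≈ det {m} (λ i j → M (i ↑ˡ n) (j ↑ˡ n)) * det {n} (λ i j → M (m ↑ʳ i) (m ↑ʳ j))
  det-lower zero M _ = sym (*-identityˡ _)
  det-lower (suc m) {n} M M≈0 = begin
    det M
      ≈⟨ sum-↑ (suc m) {n} (λ j → -1^ (toℕ j) * (M zero j * det (minor M j))) ⟩
    sum {suc m} (λ j → -1^ (toℕ (j ↑ˡ n)) * (M zero (j ↑ˡ n) * det (minor M (j ↑ˡ n)))) +
    sum {n} (λ j → -1^ (toℕ (suc m ↑ʳ j)) * (M zero (suc m ↑ʳ j) * det (minor M (suc m ↑ʳ j))))
      ≈⟨ +-cong (sum-cong-≋ {suc m} left) (sum-zero {n} right) ⟩
    sum {suc m} (λ j → -1^ (toℕ j) * (A zero j * det (minor A j)) * det B) + 0#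
      ≈⟨ +-identityʳ _ ⟩
    sum {suc m} (λ j → -1^ (toℕ j) * (A zero j * det (minor A j)) * det B)
      ≈⟨ *-distribʳ-sum (det B) (λ j → -1^ (toℕ j) * (A zero j * det (minor A j))) ⟨
    det A * det B ∎
    where
    A : Matrix (suc m) (suc m)
    A i j = M (i ↑ˡ n) (j ↑ˡ n)
    B : Matrix n n
    B i j = M (suc m ↑ʳ i) (suc m ↑ʳ j)
    right : ∀ j → -1^ (toℕ (suc m ↑ʳ j)) * (M zero (suc m ↑ʳ j) * det (minor M (suc m ↑ʳ j))) ≈ 0#
    right j = trans (*-congˡ (trans (*-congʳ (M≈0 zero j)) (zeroˡ _))) (zeroʳ _)
    left : ∀ j → -1^ (toℕ (j ↑ˡ n)) * (M zero (j ↑ˡ n) * det (minor M (j ↑ˡ n))) ≈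
                 -1^ (toℕ j) * (A zero j * det (minor A j)) * det B
    left j = begin
      -1^ (toℕ (j ↑ˡ n)) * (A zero j * det (minor M (j ↑ˡ n)))
        ≈⟨ *-cong (reflexive (≡.cong -1^_ (Fin.toℕ-↑ˡ j n))) (*-congˡ (begin
             det (minor M (j ↑ˡ n))
               ≈⟨ det-lower m (minor M (j ↑ˡ n)) (λ i k → trans
                    (reflexive (≡.cong (M (suc (i ↑ˡ n))) (punchIn-↑ˡ-↑ʳ m n j k))) (M≈0 (suc i) k)) ⟩
             det (λ i k → M (suc (i ↑ˡ n)) (punchIn (j ↑ˡ n) (k ↑ˡ n))) *
             det (λ i k → M (suc (m ↑ʳ i)) (punchIn (j ↑ˡ n) (m ↑ʳ k)))
               ≈⟨ *-cong (det-cong λ i k → reflexive (≡.cong (M (suc (i ↑ˡ n))) (punchIn-↑ˡ-↑ˡ n j k)))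
                         (det-cong λ i k → reflexive (≡.cong (M (suc (m ↑ʳ i))) (punchIn-↑ˡ-↑ʳ m n j k))) ⟩
             det (minor A j) * det B ∎)) ⟩
      -1^ (toℕ j) * (A zero j * (det (minor A j) * det B))
        ≈⟨ solve 4 (λ e x d b → e :* (x :* (d :* b)) := e :* (x :* d) :* b) refl (-1^ (toℕ j)) (A zero j) (det (minor A j)) (det B) ⟩
      -1^ (toℕ j) * (A zero j * det (minor A j)) * det B ∎

  block : ∀ {m n} → Matrix m m → Matrix m n → Matrix n m → Matrix n n → Matrix (m ℕ.+ n) (m ℕ.+ n)
  block {m} P Q R S i j =
    [ (λ i → [ P i , Q i ]′ (splitAt m j)) , (λ i → [ R i , S i ]′ (splitAt m j)) ]′ (splitAt m i)

  module _ {m n} (P : Matrix m m) (Q : Matrix m n) (R : Matrix n m) (S : Matrix n n) where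
    block-ˡˡ : ∀ i j → block P Q R S (i ↑ˡ n) (j ↑ˡ n) ≡ P i j
    block-ˡˡ i j rewrite Fin.splitAt-↑ˡ m i n | Fin.splitAt-↑ˡ m j n = ≡.refl
    block-ˡʳ : ∀ i j → block P Q R S (i ↑ˡ n) (m ↑ʳ j) ≡ Q i j
    block-ˡʳ i j rewrite Fin.splitAt-↑ˡ m i n | Fin.splitAt-↑ʳ m n j = ≡.refl
    block-ʳˡ : ∀ i j → block P Q R S (m ↑ʳ i) (j ↑ˡ n) ≡ R i j
    block-ʳˡ i j rewrite Fin.splitAt-↑ʳ m n i | Fin.splitAt-↑ˡ m j n = ≡.refl
    block-ʳʳ : ∀ i j → block P Q R S (m ↑ʳ i) (m ↑ʳ j) ≡ S i j
    block-ʳʳ i j rewrite Fin.splitAt-↑ʳ m n i | Fin.splitAt-↑ʳ m n j = ≡.refl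

  infix 9 ⊖_
  ⊖_ : ∀ {m n} → Matrix m n → Matrix m n
  (⊖ M) i j = - M i j

  ⊗-identityʳ : ∀ {m n} (M : Matrix m n) → (M ⊗ δ) ≋ᴹ M
  ⊗-identityʳ M i j = sum-δʳ (M i) j

  ⊗-⊖ʳ : ∀ {l m n} (M : Matrix l m) (N : Matrix m n) → (M ⊗ ⊖ N) ≋ᴹ ⊖ (M ⊗ N)
  ⊗-⊖ʳ {m = m} M N i j = begin
    sum {m} (λ k → M i k * - N k j)      ≈⟨ sum-cong-≋ {m} (λ k → trans (sym (-‿distribʳ-* _ _)) (sym (-1*x≈-x _))) ⟩
    sum {m} (λ k → - 1# * (M i k * N k j)) ≈⟨ *-distribˡ-sum (- 1#) (λ k → M i k * N k j) ⟨
    - 1# * (M ⊗ N) i j                   ≈⟨ -1*x≈-x _ ⟩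
    - (M ⊗ N) i j                        ∎

  ⊗-⊖ˡ : ∀ {l m n} (M : Matrix l m) (N : Matrix m n) → (⊖ M ⊗ N) ≋ᴹ ⊖ (M ⊗ N)
  ⊗-⊖ˡ {m = m} M N i j = begin
    sum {m} (λ k → - M i k * N k j)      ≈⟨ sum-cong-≋ {m} (λ k → trans (sym (-‿distribˡ-* _ _)) (sym (-1*x≈-x _))) ⟩
    sum {m} (λ k → - 1# * (M i k * N k j)) ≈⟨ *-distribˡ-sum (- 1#) (λ k → M i k * N k j) ⟨
    - 1# * (M ⊗ N) i j                   ≈⟨ -1*x≈-x _ ⟩
    - (M ⊗ N) i j                        ∎

  -- With W = [[1, A], [B, 1]] and U = [[1, -A], [0, 1]], both U W and W U are block
  -- lower triangular, with diagonals (1 - A B, 1) and (1, 1 - B A).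
  sylvester : ∀ {m n} (A : Matrix m n) (B : Matrix n m) →
    det (λ i j → δ i j - (A ⊗ B) i j) ≈ det (λ i j → δ i j - (B ⊗ A) i j)
  sylvester {m} {n} A B = begin
    det (λ i j → δ i j - (A ⊗ B) i j)           ≈⟨ *-identityʳ _ ⟨
    det (λ i j → δ i j - (A ⊗ B) i j) * 1#      ≈⟨ *-cong (det-cong UWˡˡ) (trans (det-cong UWʳʳ) (det-δ n)) ⟨
    det {m} (λ i j → (U ⊗ W) (i ↑ˡ n) (j ↑ˡ n)) * det {n} (λ i j → (U ⊗ W) (m ↑ʳ i) (m ↑ʳ j))
                                                ≈⟨ det-lower m (U ⊗ W) UWˡʳ ⟨
    det (U ⊗ W)                                 ≈⟨ det-⊗ U W ⟩
    det U * det W                               ≈⟨ *-comm _ _ ⟩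
    det W * det U                               ≈⟨ det-⊗ W U ⟨
    det (W ⊗ U)                                 ≈⟨ det-lower m (W ⊗ U) WUˡʳ ⟩
    det {m} (λ i j → (W ⊗ U) (i ↑ˡ n) (j ↑ˡ n)) * det {n} (λ i j → (W ⊗ U) (m ↑ʳ i) (m ↑ʳ j))
                                                ≈⟨ *-cong (trans (det-cong WUˡˡ) (det-δ m)) (det-cong WUʳʳ) ⟩
    1# * det (λ i j → δ i j - (B ⊗ A) i j)      ≈⟨ *-identityˡ _ ⟩
    det (λ i j → δ i j - (B ⊗ A) i j)           ∎
    where
    W U : Matrix (m ℕ.+ n) (m ℕ.+ n)
    W = block δ A B δ
    U = block δ (⊖ A) 𝟘 δ
    product-entry : ∀ (X Y : Matrix (m ℕ.+ n) (m ℕ.+ n)) i j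
      {u u′ : Row m} {v v′ : Row n} {x y} →
      (∀ k → X i (k ↑ˡ n) ≡ u k) → (∀ k → Y (k ↑ˡ n) j ≡ u′ k) →
      (∀ k → X i (m ↑ʳ k) ≡ v k) → (∀ k → Y (m ↑ʳ k) j ≡ v′ k) →
      sum (λ k → u k * u′ k) ≈ x → sum (λ k → v k * v′ k) ≈ y → (X ⊗ Y) i j ≈ x + y
    product-entry X Y i j Xl Yl Xr Yr l r = trans (sum-↑ m {n} (λ k → X i k * Y k j))
      (+-cong (trans (sum-cong-≋ {m} λ k → *-cong (reflexive (Xl k)) (reflexive (Yl k))) l)
              (trans (sum-cong-≋ {n} λ k → *-cong (reflexive (Xr k)) (reflexive (Yr k))) r))
    UWˡˡ : ∀ i j → (U ⊗ W) (i ↑ˡ n) (j ↑ˡ n) ≈ δ i j - (A ⊗ B) i j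
    UWˡˡ i j = product-entry U W (i ↑ˡ n) (j ↑ˡ n)
      (block-ˡˡ δ (⊖ A) 𝟘 δ i) (λ k → block-ˡˡ δ A B δ k j)
      (block-ˡʳ δ (⊖ A) 𝟘 δ i) (λ k → block-ʳˡ δ A B δ k j)
      (⊗-identityˡ δ i j) (⊗-⊖ˡ A B i j)
    UWˡʳ : ∀ i j → (U ⊗ W) (i ↑ˡ n) (m ↑ʳ j) ≈ 0#
    UWˡʳ i j = trans (product-entry U W (i ↑ˡ n) (m ↑ʳ j)
      (block-ˡˡ δ (⊖ A) 𝟘 δ i) (λ k → block-ˡʳ δ A B δ k j)
      (block-ˡʳ δ (⊖ A) 𝟘 δ i) (λ k → block-ʳʳ δ A B δ k j)
      (⊗-identityˡ A i j) (⊗-identityʳ (⊖ A) i j)) (-‿inverseʳ _)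
    UWʳʳ : ∀ i j → (U ⊗ W) (m ↑ʳ i) (m ↑ʳ j) ≈ δ i j
    UWʳʳ i j = trans (product-entry U W (m ↑ʳ i) (m ↑ʳ j)
      (block-ʳˡ δ (⊖ A) 𝟘 δ i) (λ k → block-ˡʳ δ A B δ k j)
      (block-ʳʳ δ (⊖ A) 𝟘 δ i) (λ k → block-ʳʳ δ A B δ k j)
      (sum-zero {m} λ k → zeroˡ (A k j)) (⊗-identityˡ δ i j)) (+-identityˡ _)
    WUˡˡ : ∀ i j → (W ⊗ U) (i ↑ˡ n) (j ↑ˡ n) ≈ δ i j
    WUˡˡ i j = trans (product-entry W U (i ↑ˡ n) (j ↑ˡ n)
      (block-ˡˡ δ A B δ i) (λ k → block-ˡˡ δ (⊖ A) 𝟘 δ k j)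
      (block-ˡʳ δ A B δ i) (λ k → block-ʳˡ δ (⊖ A) 𝟘 δ k j)
      (⊗-identityˡ δ i j) (sum-zero {n} λ k → zeroʳ (A i k))) (+-identityʳ _)
    WUˡʳ : ∀ i j → (W ⊗ U) (i ↑ˡ n) (m ↑ʳ j) ≈ 0#
    WUˡʳ i j = trans (product-entry W U (i ↑ˡ n) (m ↑ʳ j)
      (block-ˡˡ δ A B δ i) (λ k → block-ˡʳ δ (⊖ A) 𝟘 δ k j)
      (block-ˡʳ δ A B δ i) (λ k → block-ʳʳ δ (⊖ A) 𝟘 δ k j)
      (⊗-identityˡ (⊖ A) i j) (⊗-identityʳ A i j)) (-‿inverseˡ _)
    WUʳʳ : ∀ i j → (W ⊗ U) (m ↑ʳ i) (m ↑ʳ j) ≈ δ i j - (B ⊗ A) i j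
    WUʳʳ i j = trans (product-entry W U (m ↑ʳ i) (m ↑ʳ j)
      (block-ʳˡ δ A B δ i) (λ k → block-ˡʳ δ (⊖ A) 𝟘 δ k j)
      (block-ʳʳ δ A B δ i) (λ k → block-ʳʳ δ (⊖ A) 𝟘 δ k j)
      (⊗-⊖ʳ B A i j) (⊗-identityˡ δ i j)) (+-comm _ _)

  -- The reversed characteristic polynomial.

  pencil : ∀ {n} → Carrier → Matrix n n → Matrix n n
  pencil y M i j = δ i j - y * M i j

  -- The reversed characteristic polynomial: unlike charPoly, it does not see the
  -- zero eigenvalues, so that no powers of the indeterminate have to be tracked.
  ρ : ∀ {n} → Matrix n n → Carrier → Carrier
  ρ M y = det (pencil y M)

  ρ-cong : ∀ {n} {M N : Matrix n n} → M ≋ᴹ N → ∀ y → ρ M y ≈ ρ N y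
  ρ-cong M≋N y = det-cong λ i j → +-congˡ (-‿cong (*-congˡ (M≋N i j)))

  ρ-𝟘 : ∀ {n} {M : Matrix n n} → M ≋ᴹ 𝟘 → ∀ y → ρ M y ≈ 1#
  ρ-𝟘 {n} M≋𝟘 y = trans (det-cong λ i j → trans (+-congˡ (trans (-‿cong (trans (*-congˡ (M≋𝟘 i j)) (zeroʳ _))) -0#≈0#)) (+-identityʳ _)) (det-δ n)

  -- Sylvester's identity for y A and B, as the scalar can be moved into either factor. The factors
  -- may be rectangular, which is what relates d d* to d* d across different dimensions.
  ρ-⊗-comm : ∀ {m n} (A : Matrix m n) (B : Matrix n m) y → ρ (A ⊗ B) y ≈ ρ (B ⊗ A) y
  ρ-⊗-comm {m} {n} A B y = begin
    ρ (A ⊗ B) y                              ≈⟨ det-cong (λ i j → +-congˡ (-‿cong (trans (*-distribˡ-sum y (λ k → A i k * B k j))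
                                                  (sum-cong-≋ {n} λ k → sym (*-assoc y (A i k) (B k j)))))) ⟩
    det (λ i j → δ i j - (yA ⊗ B) i j)       ≈⟨ sylvester yA B ⟩
    det (λ i j → δ i j - (B ⊗ yA) i j)       ≈⟨ det-cong (λ i j → +-congˡ (-‿cong (trans (sum-cong-≋ {m} λ k →
                                                  solve 3 (λ b y a → b :* (y :* a) := y :* (b :* a)) refl (B i k) y (A k j))
                                                  (sym (*-distribˡ-sum y (λ k → B i k * A k j)))))) ⟩
    ρ (B ⊗ A) y                              ∎
    where
    yA : Matrix m n
    yA i j = y * A i j

  -- The two parameters serve two purposes: with equal ones and A B = 0 the product is the pencil of
  -- A + B, and with opposite ones and A = B the linear term cancels.
  pencil-⊗ : ∀ {n} (A B : Matrix n n) x y → ∀ i j →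
    (pencil x A ⊗ pencil y B) i j ≈
    δ i j - (x * A i j + y * B i j) + x * y * (A ⊗ B) i j
  pencil-⊗ {n} A B x y i j = begin
    sum {n} (λ k → (δ i k - x * A i k) * (δ k j - y * B k j))
      ≈⟨ sum-cong-≋ {n} (λ k → solve 6 (λ d e x y a b →
           (d :- x :* a) :* (e :- y :* b) := (d :* e :- y :* (d :* b)) :+ (:- x :* (a :* e) :+ x :* y :* (a :* b)))
           refl (δ i k) (δ k j) x y (A i k) (B k j)) ⟩
    sum {n} (λ k → (δ i k * δ k j - y * (δ i k * B k j)) + (- x * (A i k * δ k j) + x * y * (A i k * B k j)))
      ≈⟨ ∑-distrib-+ {n} (λ k → δ i k * δ k j - y * (δ i k * B k j)) (λ k → - x * (A i k * δ k j) + x * y * (A i k * B k j)) ⟩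
    sum {n} (λ k → δ i k * δ k j - y * (δ i k * B k j)) + sum {n} (λ k → - x * (A i k * δ k j) + x * y * (A i k * B k j))
      ≈⟨ +-cong (sum-linear {n} 1# (- y) (λ k → +-cong (sym (*-identityˡ _)) (-‿distribˡ-* _ _)))
                (sum-linear {n} (- x) (x * y) (λ k → refl)) ⟩
    (1# * (δ ⊗ δ) i j + - y * (δ ⊗ B) i j) + (- x * (A ⊗ δ) i j + x * y * (A ⊗ B) i j)
      ≈⟨ +-cong (+-cong (*-congˡ (⊗-identityˡ δ i j)) (*-congˡ (⊗-identityˡ B i j))) (+-congʳ (*-congˡ (⊗-identityʳ A i j))) ⟩
    (1# * δ i j + - y * B i j) + (- x * A i j + x * y * (A ⊗ B) i j)
      ≈⟨ solve 6 (λ d x y a b c → (con (+ 1) :* d :+ :- y :* b) :+ (:- x :* a :+ x :* y :* c) :=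
                                   d :- (x :* a :+ y :* b) :+ x :* y :* c) refl (δ i j) x y (A i j) (B i j) ((A ⊗ B) i j) ⟩
    δ i j - (x * A i j + y * B i j) + x * y * (A ⊗ B) i j ∎

  ρ-⊕ : ∀ {n} (A B : Matrix n n) → (A ⊗ B) ≋ᴹ 𝟘 → ∀ y → ρ (A ⊕ B) y ≈ ρ A y * ρ B y
  ρ-⊕ A B AB≋𝟘 y = trans (det-cong λ i j → sym (trans (pencil-⊗ A B y y i j)
    (trans (+-congˡ (trans (*-congˡ (AB≋𝟘 i j)) (zeroʳ _))) (trans (+-identityʳ _) (+-congˡ (-‿cong (sym (distribˡ _ _ _))))))))
    (det-⊗ (pencil y A) (pencil y B))

  ρ-square : ∀ {n} (A : Matrix n n) y → ρ (A ⊗ A) (y * y) ≈ ρ A y * ρ A (- y)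
  ρ-square A y = trans (det-cong λ i j → sym (trans (pencil-⊗ A A y (- y) i j)
    (solve 4 (λ d y a b → d :- (y :* a :+ :- y :* a) :+ y :* :- y :* b := d :- y :* y :* b) refl (δ i j) y (A i j) ((A ⊗ A) i j))))
    (det-⊗ (pencil y A) (pencil (- y) A))

  -- This rests on 1 - y M = y (x - M) for x = 1 / y. A `Spectrum` speaks about `charPoly` only, so
  -- it determines ρ at invertible arguments, and the later lemmas carry the condition `y # 0#`.
  ρ-charPoly : ∀ {n} (M : Matrix n n) x y → y * x ≈ 1# → ρ M y ≈ y ^ᴷ n * charPoly M x
  ρ-charPoly M x y yx≈1 = trans (det-cong λ i j → begin
    δ i j - y * M i j              ≈⟨ +-congʳ (trans (*-congʳ yx≈1) (*-identityˡ _)) ⟨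
    y * x * δ i j - y * M i j      ≈⟨ solve 4 (λ y x d m → y :* x :* d :- y :* m := y :* (x :* d :- m)) refl y x (δ i j) (M i j) ⟩
    y * (x * δ i j - M i j)        ≈⟨ *-congˡ (+-congʳ (δ-scalar x i j)) ⟨
    y * (scalar x i j - M i j)     ∎) (det-* y (λ i j → scalar x i j - M i j))

-- Ordered fields and polynomial functions on them.

module Polynomials {c ℓ₁ ℓ₂ ℓ₃} (K : OrderedField c ℓ₁ ℓ₂ ℓ₃) where
  open OrderedField K hiding (zero)
  open LinearAlgebra K
  open CommutativeRing commutativeRing using (ring; semiring)
  open import Algebra.Properties.Ring ring
  open import Algebra.Apartness.Properties.HeytingCommutativeRing heytingCommutativeRing
  open import Algebra.Definitions.RawSemiring (Semiring.rawSemiring semiring) using () renaming (_^_ to _^ᴷ_)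
  open import Relation.Binary.Reasoning.Setoid setoid
  open IntegerSolver commutativeRing
  open IsStrictPartialOrder isStrictPartialOrder using (<-respˡ-≈; <-respʳ-≈)
    renaming (irrefl to <-irrefl; trans to <-trans)

  inverse : ∀ {x} → x # 0# → ∃ λ y → y * x ≈ 1#
  inverse {x} x#0 with y , yx≈1 , _ ← #⇒invertible x#0 = y , trans (*-congˡ (sym (x-0≈x x))) yx≈1

  yx≈1⇒y#0 : ∀ {x y} → y * x ≈ 1# → y # 0#
  yx≈1⇒y#0 {x} {y} yx≈1 = invertibleˡ⇒# (x , trans (*-congˡ (x-0≈x y)) (trans (*-comm x y) yx≈1))

  #0-cancel : ∀ {x y} → x # 0# → x * y ≈ 0# → y ≈ 0#
  #0-cancel {x} {y} x#0 xy≈0 with z , zx≈1 ← inverse x#0 = begin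
    y            ≈⟨ *-identityˡ y ⟨
    1# * y       ≈⟨ *-congʳ zx≈1 ⟨
    z * x * y    ≈⟨ *-assoc z x y ⟩
    z * (x * y)  ≈⟨ *-congˡ xy≈0 ⟩
    z * 0#       ≈⟨ zeroʳ z ⟩
    0#           ∎

  x-y≈0⇒x≈y : ∀ {x y} → x - y ≈ 0# → x ≈ y
  x-y≈0⇒x≈y {x} {y} = x∙y⁻¹≈ε⇒x≈y x y

  #0-cancelˡ : ∀ {x y z} → x # 0# → x * y ≈ x * z → y ≈ z
  #0-cancelˡ {x} {y} {z} x#0 xy≈xz = x-y≈0⇒x≈y (#0-cancel x#0 (begin
    x * (y - z)    ≈⟨ solve 3 (λ x y z → x :* (y :- z) := x :* y :- x :* z) refl x y z ⟩
    x * y - x * z  ≈⟨ +-congʳ xy≈xz ⟩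
    x * z - x * z  ≈⟨ -‿inverseʳ _ ⟩
    0#             ∎))

  x<y⇒0<y-x : ∀ {x y} → x < y → 0# < y - x
  x<y⇒0<y-x {x} x<y = <-respˡ-≈ (-‿inverseʳ x) (+-monoˡ-< (- x) x<y)

  x<0⇒0<-x : ∀ {x} → x < 0# → 0# < - x
  x<0⇒0<-x x<0 = <-respʳ-≈ (+-identityˡ _) (x<y⇒0<y-x x<0)

  0<x⇒-x<0 : ∀ {x} → 0# < x → - x < 0#
  0<x⇒-x<0 {x} 0<x = <-respˡ-≈ (+-identityˡ _) (<-respʳ-≈ (-‿inverseʳ x) (+-monoˡ-< (- x) 0<x))

  0<x⇒x#0 : ∀ {x} → 0# < x → x # 0#
  0<x⇒x#0 = #-sym ∘ <⇒#

  +-pos : ∀ {x y} → 0# < x → 0# < y → 0# < x + y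
  +-pos {x} {y} 0<x 0<y = <-trans 0<y (<-respˡ-≈ (+-identityˡ y) (+-monoˡ-< y 0<x))

  x#0⇒0<x² : ∀ {x} → x # 0# → 0# < x * x
  x#0⇒0<x² {x} x#0 with #⇒<⊎> x#0
  ... | inj₁ x<0 = <-respʳ-≈ (solve 1 (λ x → :- x :* :- x := x :* x) refl x) (*-pos (x<0⇒0<-x x<0) (x<0⇒0<-x x<0))
  ... | inj₂ 0<x = *-pos 0<x 0<x

  0<1 : 0# < 1#
  0<1 = <-respʳ-≈ (*-identityˡ 1#) (x#0⇒0<x² 1#0)

  x<x+1 : ∀ x → x < x + 1#
  x<x+1 x = <-respˡ-≈ (+-identityˡ x) (<-respʳ-≈ (+-comm 1# x) (+-monoˡ-< x 0<1))

  -- Polynomial functions of degree at most N, via divided differences.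
  IsPoly : ℕ → (Carrier → Carrier) → Set (c ⊔ ℓ₁)
  IsPoly zero    R = ∀ x y → R x ≈ R y
  IsPoly (suc N) R = ∀ a → ∃ λ S → IsPoly N S × (∀ x → R x ≈ R a + (x - a) * S x)

  IsPoly-suc : ∀ N {R} → IsPoly N R → IsPoly (suc N) R
  IsPoly-suc zero {R} R-const a = const 0# , (λ _ _ → refl) , λ x →
    trans (R-const x a) (sym (trans (+-congˡ (zeroʳ _)) (+-identityʳ _)))
  IsPoly-suc (suc N) R-poly a with S , S-poly , R≈ ← R-poly a = S , IsPoly-suc N S-poly , R≈

  IsPoly-+ : ∀ m N {R} → IsPoly N R → IsPoly (m ℕ.+ N) R
  IsPoly-+ zero    N R-poly = R-poly
  IsPoly-+ (suc m) N R-poly = IsPoly-suc (m ℕ.+ N) (IsPoly-+ m N R-poly)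

  IsPoly-combination : ∀ N {R S} p q → IsPoly N R → IsPoly N S → IsPoly N (λ x → p * R x + q * S x)
  IsPoly-combination zero p q R-const S-const =
    λ x y → +-cong (*-congˡ (R-const x y)) (*-congˡ (S-const x y))
  IsPoly-combination (suc N) {R} {S} p q R-poly S-poly a
    with R′ , R′-poly , R≈ ← R-poly a | S′ , S′-poly , S≈ ← S-poly a =
    (λ x → p * R′ x + q * S′ x) , IsPoly-combination N p q R′-poly S′-poly , λ x →
    trans (+-cong (*-congˡ (R≈ x)) (*-congˡ (S≈ x)))
      (solve 7 (λ p q r r′ s s′ d → p :* (r :+ d :* r′) :+ q :* (s :+ d :* s′) :=
                                    (p :* r :+ q :* s) :+ d :* (p :* r′ :+ q :* s′))
        refl p q (R a) (R′ x) (S a) (S′ x) (x - a))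

  -- The product rule for divided differences: the quotient of the product at `a` is (p + q a) S + q
  -- R.
  IsPoly-*linear : ∀ N {R} p q → IsPoly N R → IsPoly (suc N) (λ x → (p + q * x) * R x)
  IsPoly-*linear zero {R} p q R-const a =
    (λ x → q * R x) , (λ x y → *-congˡ (R-const x y)) , λ x → trans
      (solve 5 (λ p q x a r → (p :+ q :* x) :* r := (p :+ q :* a) :* r :+ (x :- a) :* (q :* r)) refl p q x a (R x))
      (+-congʳ (*-congˡ (R-const x a)))
  IsPoly-*linear (suc N) {R} p q R-poly a with S , S-poly , R≈ ← R-poly a =
    (λ x → (p + q * a) * S x + q * R x) ,
    IsPoly-combination (suc N) (p + q * a) q (IsPoly-suc N S-poly) R-poly , λ x → begin
      (p + q * x) * R x
        ≈⟨ solve 5 (λ p q x a r → (p :+ q :* x) :* r := (p :+ q :* a) :* r :+ (x :- a) :* (q :* r)) refl p q x a (R x) ⟩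
      (p + q * a) * R x + (x - a) * (q * R x)
        ≈⟨ +-congʳ (*-congˡ (R≈ x)) ⟩
      (p + q * a) * (R a + (x - a) * S x) + (x - a) * (q * R x)
        ≈⟨ solve 6 (λ e r d s q r′ → e :* (r :+ d :* s) :+ d :* (q :* r′) := e :* r :+ d :* (e :* s :+ q :* r′))
             refl (p + q * a) (R a) (x - a) (S x) q (R x) ⟩
      (p + q * a) * R a + (x - a) * ((p + q * a) * S x + q * R x) ∎

  IsPoly-cong : ∀ N {R S} → (∀ x → R x ≈ S x) → IsPoly N R → IsPoly N S
  IsPoly-cong zero R≈S R-const = λ x y → trans (sym (R≈S x)) (trans (R-const x y) (R≈S y))
  IsPoly-cong (suc N) R≈S R-poly a with R′ , R′-poly , R≈ ← R-poly a =
    R′ , R′-poly , λ x → trans (sym (R≈S x)) (trans (R≈ x) (+-congʳ (R≈S a)))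

  -- Each step splits off the root a² with a = b + 1 and raises the bound to `a`. Beyond it x² - a²
  -- = (x - a) (x + a) is a product of positive factors, so it can be cancelled and the quotient
  -- vanishes at the remaining squares. The growing bound replaces a supply of distinct roots.
  IsPoly-vanish : ∀ N {R} → IsPoly N R → ∀ b → 0# < b → (∀ x → b < x → R (x * x) ≈ 0#) → ∀ y → R y ≈ 0#
  IsPoly-vanish zero R-const b 0<b R≈0 y =
    trans (R-const y ((b + 1#) * (b + 1#))) (R≈0 (b + 1#) (x<x+1 b))
  IsPoly-vanish (suc N) {R} R-poly b 0<b R≈0 y with S , S-poly , R≈ ← R-poly ((b + 1#) * (b + 1#)) = begin
    R y                            ≈⟨ R≈ y ⟩
    R (a * a) + (y - a * a) * S y  ≈⟨ +-cong (R≈0 a (x<x+1 b)) (*-congˡ (IsPoly-vanish N S-poly a 0<a S≈0 y)) ⟩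
    0# + (y - a * a) * 0#          ≈⟨ trans (+-identityˡ _) (zeroʳ _) ⟩
    0#                             ∎
    where
    a = b + 1#
    0<a : 0# < a
    0<a = <-trans 0<b (x<x+1 b)
    S≈0 : ∀ x → a < x → S (x * x) ≈ 0#
    S≈0 x a<x = #0-cancel (x#0y#0→xy#0 (0<x⇒x#0 (x<y⇒0<y-x a<x)) (0<x⇒x#0 (+-pos (<-trans 0<a a<x) 0<a))) (begin
      (x - a) * (x + a) * S (x * x)            ≈⟨ *-congʳ (solve 2 (λ x a → (x :- a) :* (x :+ a) := x :* x :- a :* a) refl x a) ⟩
      (x * x - a * a) * S (x * x)              ≈⟨ +-identityˡ _ ⟨
      0# + (x * x - a * a) * S (x * x)         ≈⟨ +-congʳ (R≈0 a (x<x+1 b)) ⟨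
      R (a * a) + (x * x - a * a) * S (x * x)  ≈⟨ R≈ (x * x) ⟨
      R (x * x)                                ≈⟨ R≈0 x (<-trans (x<x+1 b) a<x) ⟩
      0#                                       ∎)

  IsPoly-≈ : ∀ M N {R S} → IsPoly M R → IsPoly N S → (∀ x → x # 0# → R (x * x) ≈ S (x * x)) → ∀ y → R y ≈ S y
  IsPoly-≈ M N {R} {S} R-poly S-poly R≈S y = x-y≈0⇒x≈y (trans (+-cong (sym (*-identityˡ _)) (sym (-1*x≈-x _)))
    (IsPoly-vanish (N ℕ.+ M)
      (IsPoly-combination (N ℕ.+ M) 1# (- 1#) (IsPoly-+ N M R-poly)
        (≡.subst (λ k → IsPoly k S) (ℕ.+-comm M N) (IsPoly-+ M N S-poly)))
      -- The bound `1#` makes all test points positive, hence apart from `0#`, as `R≈S` requires.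
      1# 0<1 (λ x 1<x → trans (+-cong (*-identityˡ _) (-1*x≈-x _))
        (trans (+-congʳ (R≈S x (0<x⇒x#0 (<-trans 0<1 1<x)))) (-‿inverseʳ _))) y))

  IsPoly-^* : ∀ m N {R} → IsPoly N R → IsPoly (m ℕ.+ N) (λ x → x ^ᴷ m * R x)
  IsPoly-^* zero    N R-poly = IsPoly-cong N (λ x → sym (*-identityˡ _)) R-poly
  IsPoly-^* (suc m) N {R} R-poly = IsPoly-cong (suc m ℕ.+ N)
    (λ x → trans (*-congʳ (trans (+-identityˡ _) (*-identityˡ x))) (sym (*-assoc x (x ^ᴷ m) (R x))))
    (IsPoly-*linear (m ℕ.+ N) 0# 1# (IsPoly-^* m N R-poly))

  -- Both the order of vanishing at 0 and the first nonzero coefficient are determined. Common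
  -- factors `x` cancel at nonzero points; once one exponent is used up, the identity extends to 0
  -- by `IsPoly-≈`, and a power left on the other side would contradict the nonzero value there.
  order-unique : ∀ m n M N {R S} → IsPoly M R → IsPoly N S → R 0# # 0# → S 0# # 0# →
    (∀ x → x # 0# → x ^ᴷ m * R x ≈ x ^ᴷ n * S x) → m ≡ n × R 0# ≈ S 0#
  order-unique zero zero M N R-poly S-poly _ _ R≈S = ≡.refl , IsPoly-≈ M N R-poly S-poly (λ x x#0 →
    #0-cancelˡ 1#0 (R≈S (x * x) (x#0y#0→xy#0 x#0 x#0))) 0#
  order-unique zero (suc n) M N {R} {S} R-poly S-poly R0#0 _ R≈S = ⊥-elim (#-irrefl (begin
    R 0#                       ≈⟨ IsPoly-≈ M (suc n ℕ.+ N) R-poly (IsPoly-^* (suc n) N S-poly)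
                                    (λ x x#0 → trans (sym (*-identityˡ _)) (R≈S (x * x) (x#0y#0→xy#0 x#0 x#0))) 0# ⟩
    0# * 0# ^ᴷ n * S 0#        ≈⟨ trans (*-congʳ (zeroˡ _)) (zeroˡ _) ⟩
    0#                         ∎) R0#0)
  order-unique (suc m) zero M N {R} {S} R-poly S-poly _ S0#0 R≈S = ⊥-elim (#-irrefl (begin
    S 0#                       ≈⟨ IsPoly-≈ N (suc m ℕ.+ M) S-poly (IsPoly-^* (suc m) M R-poly)
                                    (λ x x#0 → trans (sym (*-identityˡ _)) (sym (R≈S (x * x) (x#0y#0→xy#0 x#0 x#0)))) 0# ⟩
    0# * 0# ^ᴷ m * R 0#        ≈⟨ trans (*-congʳ (zeroˡ _)) (zeroˡ _) ⟩
    0#                         ∎) S0#0)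
  order-unique (suc m) (suc n) M N R-poly S-poly R0#0 S0#0 R≈S =
    let m≡n , R0≈S0 = order-unique m n M N R-poly S-poly R0#0 S0#0 (λ x x#0 →
          #0-cancelˡ x#0 (trans (sym (*-assoc _ _ _)) (trans (R≈S x x#0) (*-assoc _ _ _))))
    in ≡.cong suc m≡n , R0≈S0

  -- Products of linear factors with nonzero roots.

  reversed : List K× → Carrier → Carrier
  reversed []      y = 1#
  reversed (a ∷ l) y = (1# - y * val a) * reversed l y

  listProduct : List K× → Carrier
  listProduct []      = 1#
  listProduct (a ∷ l) = val a * listProduct l

  -- The factor x - a is written in the shape `p + q * x` of `IsPoly-*linear`. The value at 0 is, up
  -- to sign, the leading coefficient of `reversed`.
  monic : List K× → Carrier → Carrier
  monic []      x = 1#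
  monic (a ∷ l) x = (- val a + 1# * x) * monic l x

  reversed-IsPoly : ∀ l → IsPoly (length l) (reversed l)
  reversed-IsPoly []      = λ _ _ → refl
  reversed-IsPoly (a ∷ l) = IsPoly-cong (suc (length l))
    (λ x → *-congʳ (solve 2 (λ x a → con (+ 1) :+ :- a :* x := con (+ 1) :- x :* a) refl x (val a)))
    (IsPoly-*linear (length l) 1# (- val a) (reversed-IsPoly l))

  monic-IsPoly : ∀ l → IsPoly (length l) (monic l)
  monic-IsPoly []      = λ _ _ → refl
  monic-IsPoly (a ∷ l) = IsPoly-*linear (length l) (- val a) 1# (monic-IsPoly l)

  monic-reversed : ∀ l {x y} → y * x ≈ 1# → monic l x ≈ x ^ᴷ length l * reversed l y
  monic-reversed []      yx≈1 = sym (*-identityˡ 1#)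
  monic-reversed (a ∷ l) {x} {y} yx≈1 = begin
    (- val a + 1# * x) * monic l x                    ≈⟨ *-congˡ (monic-reversed l yx≈1) ⟩
    (- val a + 1# * x) * (x ^ᴷ length l * reversed l y) ≈⟨ *-congʳ (begin
      - val a + 1# * x                ≈⟨ +-congʳ (-‿cong (trans (*-congʳ yx≈1) (*-identityˡ _))) ⟨
      - (y * x * val a) + 1# * x      ≈⟨ solve 3 (λ x y a → :- (y :* x :* a) :+ con (+ 1) :* x := x :* (con (+ 1) :- y :* a)) refl x y (val a) ⟩
      x * (1# - y * val a)            ∎) ⟩
    x * (1# - y * val a) * (x ^ᴷ length l * reversed l y)
      ≈⟨ solve 4 (λ x d p r → x :* d :* (p :* r) := x :* p :* (d :* r)) refl x (1# - y * val a) (x ^ᴷ length l) (reversed l y) ⟩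
    x * x ^ᴷ length l * ((1# - y * val a) * reversed l y) ∎

  monic-0 : ∀ l → monic l 0# ≈ -1^ (length l) * listProduct l
  monic-0 []      = sym (*-identityˡ 1#)
  monic-0 (a ∷ l) = trans (*-congˡ (monic-0 l))
    (solve 3 (λ a e p → (:- a :+ con (+ 1) :* con (+ 0)) :* (e :* p) := (:- con (+ 1) :* e) :* (a :* p)) refl
      (val a) (-1^ (length l)) (listProduct l))

  -1#0 : - 1# # 0#
  -1#0 = yx≈1⇒y#0 {x = - 1#} (solve 0 (:- con (+ 1) :* :- con (+ 1) := con (+ 1)) refl)

  -1^#0 : ∀ n → -1^ n # 0#
  -1^#0 zero    = 1#0
  -1^#0 (suc n) = x#0y#0→xy#0 -1#0 (-1^#0 n)

  listProduct#0 : ∀ l → listProduct l # 0#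
  listProduct#0 []      = 1#0
  listProduct#0 (a ∷ l) = x#0y#0→xy#0 (nonzero a) (listProduct#0 l)

  monic-0#0 : ∀ l → monic l 0# # 0#
  monic-0#0 l = #-congʳ (sym (monic-0 l)) (x#0y#0→xy#0 (-1^#0 (length l)) (listProduct#0 l))

  reversed-≈ : ∀ l l′ → (∀ y → y # 0# → reversed l (y * y) ≈ reversed l′ (y * y)) →
    ∀ t → reversed l t ≈ reversed l′ t
  reversed-≈ l l′ = IsPoly-≈ (length l) (length l′) (reversed-IsPoly l) (reversed-IsPoly l′)

  -- Passing to `monic` turns the leading coefficient into a value at 0. The lists may a priori
  -- differ in length, so `order-unique` has to give equal lengths as well: otherwise the signs in
  -- `monic-0` could differ.
  listProduct-unique : ∀ l l′ → (∀ t → reversed l t ≈ reversed l′ t) → listProduct l ≈ listProduct l′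
  listProduct-unique l l′ l≈l′ = #0-cancelˡ (-1^#0 (length l)) (begin
    -1^ (length l) * listProduct l    ≈⟨ monic-0 l ⟨
    monic l 0#                        ≈⟨ proj₂ unique ⟩
    monic l′ 0#                       ≈⟨ monic-0 l′ ⟩
    -1^ (length l′) * listProduct l′  ≡⟨ ≡.cong (λ k → -1^ k * listProduct l′) (proj₁ unique) ⟩
    -1^ (length l) * listProduct l′   ∎)
    where
    unique : length l′ ≡ length l × monic l 0# ≈ monic l′ 0#
    -- Each `monic` is multiplied by the power of `x` that belongs to the other list, so that both
    -- sides carry the same total power before their lengths are known to agree.
    unique = order-unique (length l′) (length l) (length l) (length l′) (monic-IsPoly l) (monic-IsPoly l′)
      (monic-0#0 l) (monic-0#0 l′) λ x x#0 → let y , yx≈1 = inverse x#0 in begin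
        x ^ᴷ length l′ * monic l x                            ≈⟨ *-congˡ (monic-reversed l yx≈1) ⟩
        x ^ᴷ length l′ * (x ^ᴷ length l * reversed l y)       ≈⟨ *-congˡ (*-congˡ (l≈l′ y)) ⟩
        x ^ᴷ length l′ * (x ^ᴷ length l * reversed l′ y)      ≈⟨ solve 3 (λ a b c → a :* (b :* c) := b :* (a :* c)) refl
                                                                  (x ^ᴷ length l′) (x ^ᴷ length l) (reversed l′ y) ⟩
        x ^ᴷ length l * (x ^ᴷ length l′ * reversed l′ y)      ≈⟨ *-congˡ (monic-reversed l′ yx≈1) ⟨
        x ^ᴷ length l * monic l′ x                            ∎

  reversed-++ : ∀ l l′ y → reversed (l ++ l′) y ≈ reversed l y * reversed l′ y
  reversed-++ []      l′ y = sym (*-identityˡ _)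
  reversed-++ (a ∷ l) l′ y = trans (*-congˡ (reversed-++ l l′ y)) (sym (*-assoc _ _ _))

  listProduct-++ : ∀ l l′ → listProduct (l ++ l′) ≈ listProduct l * listProduct l′
  listProduct-++ []      l′ = sym (*-identityˡ _)
  listProduct-++ (a ∷ l) l′ = trans (*-congˡ (listProduct-++ l l′)) (sym (*-assoc _ _ _))

  squares : List K× → List K×
  squares = map (λ a → a · a)

  reversed-squares : ∀ l y → reversed (squares l) (y * y) ≈ reversed l y * reversed l (- y)
  reversed-squares []      y = sym (*-identityˡ 1#)
  reversed-squares (a ∷ l) y = trans (*-congˡ (reversed-squares l y))
    (solve 4 (λ y a r s → (con (+ 1) :- y :* y :* (a :* a)) :* (r :* s) :=
                          (con (+ 1) :- y :* a) :* r :* ((con (+ 1) :- :- y :* a) :* s)) refl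
      y (val a) (reversed l y) (reversed l (- y)))

  listProduct-squares : ∀ l → listProduct (squares l) ≈ listProduct l * listProduct l
  listProduct-squares []      = sym (*-identityˡ 1#)
  listProduct-squares (a ∷ l) = trans (*-congˡ (listProduct-squares l))
    (solve 2 (λ a p → a :* a :* (p :* p) := a :* p :* (a :* p)) refl (val a) (listProduct l))

  reversed-root : ∀ {a l t} → a ∈ l → t * val a ≈ 1# → reversed l t ≈ 0#
  reversed-root (here ≡.refl) ta≈1 = trans (*-congʳ (trans (+-congˡ (-‿cong ta≈1)) (-‿inverseʳ 1#))) (zeroˡ _)
  reversed-root (there a∈l)   ta≈1 = trans (*-congˡ (reversed-root a∈l ta≈1)) (zeroʳ _)

  -- For a < 0 and t = 1 / a, every factor 1 - t b² = t (a - b²) is nonzero.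
  reversed-squares#0 : ∀ l {a t} → a < 0# → t * a ≈ 1# → reversed (squares l) t # 0#
  reversed-squares#0 []      a<0 ta≈1 = 1#0
  reversed-squares#0 (b ∷ l) {a} {t} a<0 ta≈1 = x#0y#0→xy#0
    (#-congʳ (trans (distribˡ t a (- (val b * val b))) (+-cong ta≈1 (sym (-‿distribʳ-* t _))))
      (x#0y#0→xy#0 (yx≈1⇒y#0 ta≈1) (<⇒# (<-trans
        (<-respʳ-≈ (+-identityˡ _) (+-monoˡ-< (- (val b * val b)) a<0))
        (0<x⇒-x<0 (x#0⇒0<x² (nonzero b)))))))
    (reversed-squares#0 l a<0 ta≈1)

  -- The apartness proof carried by an element of `K×` decides its sign, although the order itself
  -- is not decidable. A negative entry of `l′` would make its inverse a zero of the right side,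
  -- which `reversed-squares#0` forbids on the left.
  squares⇒positive : ∀ l l′ → (∀ t → reversed (squares l) t ≈ reversed l′ t) → All (λ a → 0# < val a) l′
  squares⇒positive l l′ l≈l′ = All.tabulate λ {a} a∈l′ → [ (λ a<0 → ⊥-elim (negative a∈l′ a<0)) , (λ 0<a → 0<a) ]′ (#⇒<⊎> (nonzero a))
    where
    negative : ∀ {a} → a ∈ l′ → val a < 0# → ⊥
    negative {a} a∈l′ a<0 with t , ta≈1 ← inverse (nonzero a) =
      #-irrefl (trans (l≈l′ t) (reversed-root a∈l′ ta≈1)) (reversed-squares#0 l a<0 ta≈1)

  listProduct-positive : ∀ {l} → All (λ a → 0# < val a) l → 0# < listProduct l
  listProduct-positive []          = 0<1
  listProduct-positive (0<a ∷ l>0) = *-pos 0<a (listProduct-positive l>0)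

  -- In (|a| + b) (|a| - b) = 0 the first factor is positive and can be cancelled.
  ∣∣-unique : ∀ a {b} → 0# < b → val a * val a ≈ b * b → val ∣ a ∣ ≈ b
  ∣∣-unique a {b} 0<b a²≈b² with #⇒<⊎> (nonzero a)
  ... | inj₁ a<0 = x-y≈0⇒x≈y (#0-cancel (0<x⇒x#0 (+-pos (x<0⇒0<-x a<0) 0<b)) (begin
    (- val a + b) * (- val a - b)  ≈⟨ solve 2 (λ a b → (:- a :+ b) :* (:- a :- b) := a :* a :- b :* b) refl (val a) b ⟩
    val a * val a - b * b          ≈⟨ +-congʳ a²≈b² ⟩
    b * b - b * b                  ≈⟨ -‿inverseʳ _ ⟩
    0#                             ∎))
  ... | inj₂ 0<a = x-y≈0⇒x≈y (#0-cancel (0<x⇒x#0 (+-pos 0<a 0<b)) (begin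
    (val a + b) * (val a - b)      ≈⟨ solve 2 (λ a b → (a :+ b) :* (a :- b) := a :* a :- b :* b) refl (val a) b ⟩
    val a * val a - b * b          ≈⟨ +-congʳ a²≈b² ⟩
    b * b - b * b                  ≈⟨ -‿inverseʳ _ ⟩
    0#                             ∎))

-- Pseudo determinants read off from the reversed characteristic polynomial.

module Spectra {c ℓ₁ ℓ₂ ℓ₃} (K : OrderedField c ℓ₁ ℓ₂ ℓ₃) where
  open OrderedField K hiding (zero)
  open LinearAlgebra K
  open CommutativeRing commutativeRing using (ring; semiring)
  open import Algebra.Properties.Ring ring
  open import Algebra.Apartness.Properties.HeytingCommutativeRing heytingCommutativeRing
  open import Algebra.Definitions.RawSemiring (Semiring.rawSemiring semiring) using (product) renaming (_^_ to _^ᴷ_)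
  open import Relation.Binary.Reasoning.Setoid setoid
  open IntegerSolver commutativeRing
  open Determinants K
  open Polynomials K

  module _ {n} {M : Matrix n n} (σ : Spectrum M) where
    open Spectrum σ

    collect : List (Fin n) → List K×
    collect []       = []
    collect (i ∷ is) with zero⊎# i
    ... | inj₁ _ = collect is
    ... | inj₂ p = (eigenvalue i , p) ∷ collect is

    nonzeroEigenvalues : List K×
    nonzeroEigenvalues = collect (allFin n)

    Det-listProduct : val (Det σ) ≈ listProduct nonzeroEigenvalues
    Det-listProduct = go (allFin n)
      where
      go : ∀ is → val (∏ is nonzeroPart) ≈ listProduct (collect is)
      go []       = refl
      go (i ∷ is) with zero⊎# i
      ... | inj₁ _ = trans (*-identityˡ _) (go is)
      ... | inj₂ p = *-congˡ (go is)

    -- The map `g` is there for the induction along `allFin n`, which is `tabulate id`. A zero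
    -- eigenvalue contributes the factor 1 - y 0 = 1, just as `collect` skips it.
    reversed-collect : ∀ {x y} → y * x ≈ 1# → ∀ m (g : Fin m → Fin n) →
      y ^ᴷ m * product (λ i → x - eigenvalue (g i)) ≈ reversed (collect (tabulate g)) y
    reversed-collect {x} {y} yx≈1 zero    g = *-identityˡ 1#
    reversed-collect {x} {y} yx≈1 (suc m) g = trans (begin
      y * y ^ᴷ m * ((x - e) * p)        ≈⟨ solve 5 (λ x y e q p → y :* q :* ((x :- e) :* p) := (y :* x :- y :* e) :* (q :* p)) refl x y e (y ^ᴷ m) p ⟩
      (y * x - y * e) * (y ^ᴷ m * p)    ≈⟨ *-cong (+-congʳ yx≈1) (reversed-collect yx≈1 m (g ∘ suc)) ⟩
      (1# - y * e) * reversed (collect (tabulate (g ∘ suc))) y ∎) factor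
      where
      e = eigenvalue (g zero)
      p = product (λ i → x - eigenvalue (g (suc i)))
      factor : (1# - y * e) * reversed (collect (tabulate (g ∘ suc))) y ≈ reversed (collect (tabulate g)) y
      factor with zero⊎# (g zero)
      ... | inj₁ e≈0 = trans (*-congʳ (trans (+-congˡ (trans (-‿cong (trans (*-congˡ e≈0) (zeroʳ y))) -0#≈0#)) (+-identityʳ 1#))) (*-identityˡ _)
      ... | inj₂ p = refl

    ρ-reversed : ∀ {y} → y # 0# → ρ M y ≈ reversed nonzeroEigenvalues y
    ρ-reversed {y} y#0 with x , xy≈1 ← inverse y#0 = begin
      ρ M y                                          ≈⟨ ρ-charPoly M x y yx≈1 ⟩
      y ^ᴷ n * charPoly M x                          ≈⟨ *-congˡ (splits x) ⟩
      y ^ᴷ n * product (λ i → x - eigenvalue i)      ≈⟨ reversed-collect yx≈1 n id ⟩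
      reversed nonzeroEigenvalues y                  ∎
      where yx≈1 = trans (*-comm y x) xy≈1

  -- Any factorisation of ρ with nonzero roots computes `Det`, whatever the matrix size or the
  -- number of zero eigenvalues. Thus lists coming from spectra of other matrices may be used.
  Det-unique : ∀ {n} {M : Matrix n n} (σ : Spectrum M) l → (∀ y → y # 0# → ρ M y ≈ reversed l y) →
    val (Det σ) ≈ listProduct l
  Det-unique σ l ρM≈ = trans (Det-listProduct σ) (listProduct-unique (nonzeroEigenvalues σ) l
    (reversed-≈ (nonzeroEigenvalues σ) l λ y y#0 → let yy#0 = x#0y#0→xy#0 y#0 y#0 in
      trans (sym (ρ-reversed σ yy#0)) (ρM≈ (y * y) yy#0)))

  Det-𝟘 : ∀ {n} {M : Matrix n n} (σ : Spectrum M) → M ≋ᴹ 𝟘 → val (Det σ) ≈ 1#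
  Det-𝟘 σ M≋𝟘 = Det-unique σ [] λ y _ → ρ-𝟘 M≋𝟘 y

  Det-* : ∀ {l m n} {L : Matrix l l} {M : Matrix m m} {N : Matrix n n}
    (σ : Spectrum L) (τ : Spectrum M) (υ : Spectrum N) → (∀ y → ρ L y ≈ ρ M y * ρ N y) →
    val (Det σ) ≈ val (Det τ) * val (Det υ)
  Det-* σ τ υ ρL≈ = begin
    val (Det σ)                       ≈⟨ Det-unique σ (μs ++ νs) (λ y y#0 → trans (ρL≈ y)
                                           (trans (*-cong (ρ-reversed τ y#0) (ρ-reversed υ y#0)) (sym (reversed-++ μs νs y)))) ⟩
    listProduct (μs ++ νs)            ≈⟨ listProduct-++ μs νs ⟩
    listProduct μs * listProduct νs   ≈⟨ *-cong (Det-listProduct τ) (Det-listProduct υ) ⟨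
    val (Det τ) * val (Det υ)         ∎
    where
    μs = nonzeroEigenvalues τ
    νs = nonzeroEigenvalues υ

  -- Since the nonzero eigenvalues of the blocks, each taken twice, are the squares of
  -- those of D, they are positive: this determines the sign of the square root.
  ∣Det∣-blocks : ∀ {n} {D : Matrix n n} (σ : Spectrum D) {i} {I : Set i} (is : List I) {m : I → ℕ}
    {B : ∀ i → Matrix (m i) (m i)} (τ : ∀ i → Spectrum (B i)) →
    (∀ t → ρ (D ⊗ D) t ≈ foldr (λ i x → ρ (B i) t * x) 1# is * foldr (λ i x → ρ (B i) t * x) 1# is) →
    val ∣ Det σ ∣ ≈ val (∏[ i ← is ] Det (τ i))
  ∣Det∣-blocks {D = D} σ {I = I} is {B = B} τ ρDD≈ = trans (∣∣-unique (Det σ) 0<Πμs (begin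
      val (Det σ) * val (Det σ)              ≈⟨ *-cong (Det-listProduct σ) (Det-listProduct σ) ⟩
      listProduct λs * listProduct λs        ≈⟨ listProduct-squares λs ⟨
      listProduct (squares λs)               ≈⟨ listProduct-unique (squares λs) (μs ++ μs) squares≈ ⟩
      listProduct (μs ++ μs)                 ≈⟨ listProduct-++ μs μs ⟩
      listProduct μs * listProduct μs        ∎)) (sym (Πμs is))
    where
    λs = nonzeroEigenvalues σ
    blocks : List I → List K×
    blocks []       = []
    blocks (i ∷ is) = nonzeroEigenvalues (τ i) ++ blocks is
    μs = blocks is
    Πμs : ∀ is → val (∏[ i ← is ] Det (τ i)) ≈ listProduct (blocks is)
    Πμs []       = refl
    Πμs (i ∷ is) = trans (*-cong (Det-listProduct (τ i)) (Πμs is)) (sym (listProduct-++ (nonzeroEigenvalues (τ i)) (blocks is)))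
    ρ-blocks : ∀ {y} → y # 0# → ∀ is → foldr (λ i x → ρ (B i) y * x) 1# is ≈ reversed (blocks is) y
    ρ-blocks {y} y#0 []       = refl
    ρ-blocks {y} y#0 (i ∷ is) = trans (*-cong (ρ-reversed (τ i) y#0) (ρ-blocks y#0 is))
      (sym (reversed-++ (nonzeroEigenvalues (τ i)) (blocks is) y))
    squares≈ : ∀ t → reversed (squares λs) t ≈ reversed (μs ++ μs) t
    squares≈ = reversed-≈ (squares λs) (μs ++ μs) λ y y#0 →
      let -y#0 = #-congʳ (-1*x≈-x y) (x#0y#0→xy#0 -1#0 y#0)
          yy#0 = x#0y#0→xy#0 y#0 y#0 in begin
      reversed (squares λs) (y * y)             ≈⟨ reversed-squares λs y ⟩
      reversed λs y * reversed λs (- y)         ≈⟨ *-cong (ρ-reversed σ y#0) (ρ-reversed σ -y#0) ⟨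
      ρ D y * ρ D (- y)                         ≈⟨ ρ-square D y ⟨
      ρ (D ⊗ D) (y * y)                         ≈⟨ ρDD≈ (y * y) ⟩
      foldr (λ i x → ρ (B i) (y * y) * x) 1# is * foldr (λ i x → ρ (B i) (y * y) * x) 1# is
                                                ≈⟨ *-cong (ρ-blocks yy#0 is) (ρ-blocks yy#0 is) ⟩
      reversed μs (y * y) * reversed μs (y * y) ≈⟨ reversed-++ μs μs (y * y) ⟨
      reversed (μs ++ μs) (y * y)               ∎
    0<Πμs : 0# < listProduct μs
    0<Πμs = listProduct-positive (++⁻ˡ μs (squares⇒positive λs (μs ++ μs) squares≈))

-- An inductive family in place of an equation with `removeAt`: its two constructors follow the
-- recursion of `∂`, so that a summand of `∂ g x` belongs to a face by construction.
data Face {a} {A : Set a} : List A → List A → Set a where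
  here  : ∀ {v vs} → Face vs (v ∷ vs)
  there : ∀ {v u vs} → Face u vs → Face (v ∷ u) (v ∷ vs)

Face-removeAt : ∀ {a} {A : Set a} {u x : List A} → Face u x → ∃ λ i → removeAt x i ≡ u
Face-removeAt here         = zero , ≡.refl
Face-removeAt (there u⊂vs) with i , ≡.refl ← Face-removeAt u⊂vs = suc i , ≡.refl

Face-length : ∀ {a} {A : Set a} {u x : List A} → Face u x → length x ≡ suc (length u)
Face-length here         = ≡.refl
Face-length (there u⊂vs) = ≡.cong suc (Face-length u⊂vs)

Face-All : ∀ {a p} {A : Set a} {P : A → Set p} {u x : List A} → Face u x → All P x → All P u
Face-All here         (_ ∷ ps)  = ps
Face-All (there u⊂vs) (p ∷ ps)  = p ∷ Face-All u⊂vs ps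

Face-AllPairs : ∀ {a r} {A : Set a} {R : A → A → Set r} {u x : List A} → Face u x → AllPairs R x → AllPairs R u
Face-AllPairs here         (_ ∷ ps) = ps
Face-AllPairs (there u⊂vs) (p ∷ ps) = Face-All u⊂vs p ∷ Face-AllPairs u⊂vs ps

-- Alternating sums over the faces of a list, and indicator functions.

module Chains {c ℓ₁ ℓ₂ ℓ₃} (K : OrderedField c ℓ₁ ℓ₂ ℓ₃) where
  open OrderedField K hiding (zero)
  open LinearAlgebra K
  open CommutativeRing commutativeRing using (ring; semiring)
  open import Algebra.Properties.Ring ring
  open import Algebra.Properties.Semiring.Sum semiring using (sum; sum-cong-≋)
  open import Relation.Binary.Reasoning.Setoid setoid
  open IntegerSolver commutativeRing
  open Determinants K using (sum-zero)

  private variable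
    a b : Level
    A B : Set a

  -- Indexing through `lookup` makes the entries of matrix products over lists of simplices such
  -- sums by definition.
  listSum : List A → (A → Carrier) → Carrier
  listSum xs g = sum (λ i → g (lookup xs i))

  listSum-cong : ∀ (xs : List A) {g h} → (∀ {x} → x ∈ xs → g x ≈ h x) → listSum xs g ≈ listSum xs h
  listSum-cong xs g≈h = sum-cong-≋ {length xs} λ i → g≈h (∈-lookup i)

  listSum-zero : ∀ (xs : List A) {g} → (∀ {x} → x ∈ xs → g x ≈ 0#) → listSum xs g ≈ 0#
  listSum-zero xs g≈0 = sum-zero {length xs} λ i → g≈0 (∈-lookup i)

  listSum-++ : ∀ (xs ys : List A) g → listSum (xs ++ ys) g ≈ listSum xs g + listSum ys g
  listSum-++ []       ys g = sym (+-identityˡ _)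
  listSum-++ (x ∷ xs) ys g = trans (+-congˡ (listSum-++ xs ys g)) (sym (+-assoc _ _ _))

  listSum-concatMap : ∀ (f : A → List B) xs g → listSum (concatMap f xs) g ≈ listSum xs (λ x → listSum (f x) g)
  listSum-concatMap f []       g = refl
  listSum-concatMap f (x ∷ xs) g = trans (listSum-++ (f x) (concatMap f xs) g) (+-congˡ (listSum-concatMap f xs g))

  listSum-single : ∀ {xs : List A} {x} g → Unique xs → x ∈ xs → (∀ {y} → y ≢ x → g y ≈ 0#) → listSum xs g ≈ g x
  listSum-single {xs = x ∷ xs} g (x∉xs ∷ _) (here ≡.refl) g≈0 =
    trans (+-congˡ (listSum-zero xs λ y∈xs → g≈0 λ y≡x → All.lookup x∉xs y∈xs (≡.sym y≡x))) (+-identityʳ _)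
  listSum-single {xs = y ∷ xs} g (y∉xs ∷ xs-unique) (there x∈xs) g≈0 =
    trans (+-cong (g≈0 (All.lookup y∉xs x∈xs)) (listSum-single g xs-unique x∈xs g≈0)) (+-identityˡ _)

  -- ∂ g x is the alternating sum Σᵢ (-1)ⁱ g (x ∖ {vᵢ}).
  ∂ : (List A → Carrier) → List A → Carrier
  ∂ g []       = 0#
  ∂ g (v ∷ vs) = g vs - ∂ (g ∘ (v ∷_)) vs

  ∂-cong : ∀ {g h : List A → Carrier} x → (∀ {u} → Face u x → g u ≈ h u) → ∂ g x ≈ ∂ h x
  ∂-cong []       g≈h = refl
  ∂-cong (v ∷ vs) g≈h = +-cong (g≈h here) (-‿cong (∂-cong vs (g≈h ∘ there)))

  ∂-combination : ∀ p q (g h : List A → Carrier) x → ∂ (λ u → p * g u + q * h u) x ≈ p * ∂ g x + q * ∂ h x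
  ∂-combination p q g h []       = sym (trans (+-cong (zeroʳ p) (zeroʳ q)) (+-identityˡ _))
  ∂-combination p q g h (v ∷ vs) = trans (+-congˡ (-‿cong (∂-combination p q (g ∘ (v ∷_)) (h ∘ (v ∷_)) vs)))
    (solve 6 (λ p q g h g′ h′ → (p :* g :+ q :* h) :- (p :* g′ :+ q :* h′) := p :* (g :- g′) :+ q :* (h :- h′))
      refl p q (g vs) (h vs) (∂ (g ∘ (v ∷_)) vs) (∂ (h ∘ (v ∷_)) vs))

  ∂-zero : ∀ {g : List A → Carrier} x → (∀ {u} → Face u x → g u ≈ 0#) → ∂ g x ≈ 0#
  ∂-zero []       g≈0 = refl
  ∂-zero (v ∷ vs) g≈0 = trans (+-cong (g≈0 here) (trans (-‿cong (∂-zero vs (g≈0 ∘ there))) -0#≈0#)) (+-identityˡ _)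

  ∂-listSum : ∀ (ys : List B) (p : B → Carrier) (g : B → List A → Carrier) x →
    ∂ (λ u → listSum ys (λ y → p y * g y u)) x ≈ listSum ys (λ y → p y * ∂ (g y) x)
  ∂-listSum []       p g x = ∂-zero x λ _ → refl
  ∂-listSum (y ∷ ys) p g x = begin
    ∂ (λ u → p y * g y u + listSum ys (λ y → p y * g y u)) x
      ≈⟨ ∂-cong x (λ _ → +-congˡ (*-identityˡ _)) ⟨
    ∂ (λ u → p y * g y u + 1# * listSum ys (λ y → p y * g y u)) x
      ≈⟨ ∂-combination (p y) 1# (g y) (λ u → listSum ys (λ y → p y * g y u)) x ⟩
    p y * ∂ (g y) x + 1# * ∂ (λ u → listSum ys (λ y → p y * g y u)) x
      ≈⟨ +-congˡ (trans (*-identityˡ _) (∂-listSum ys p g x)) ⟩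
    p y * ∂ (g y) x + listSum ys (λ y → p y * ∂ (g y) x) ∎

  -- The term `∂ g vs` arises twice, with the head `v` removed first and with it removed second, and
  -- the signs are opposite. What is left keeps `v` and falls to the induction.
  ∂∂≈0 : ∀ (g : List A → Carrier) x → ∂ (∂ g) x ≈ 0#
  ∂∂≈0 g []       = refl
  ∂∂≈0 g (v ∷ vs) = begin
    ∂ g vs - ∂ (λ u → g u - ∂ (g ∘ (v ∷_)) u) vs
      ≈⟨ +-congˡ (-‿cong (trans (∂-cong vs λ _ → +-cong (sym (*-identityˡ _)) (sym (-1*x≈-x _)))
           (∂-combination 1# (- 1#) g (∂ (g ∘ (v ∷_))) vs))) ⟩
    ∂ g vs - (1# * ∂ g vs + - 1# * ∂ (∂ (g ∘ (v ∷_))) vs)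
      ≈⟨ solve 2 (λ x y → x :- (con (+ 1) :* x :+ :- con (+ 1) :* y) := y) refl (∂ g vs) (∂ (∂ (g ∘ (v ∷_))) vs) ⟩
    ∂ (∂ (g ∘ (v ∷_))) vs
      ≈⟨ ∂∂≈0 (g ∘ (v ∷_)) vs ⟩
    0# ∎

  χ : ∀ {n} → List (Fin n) → List (Fin n) → Carrier
  χ z u with ≡-dec Fin._≟_ u z
  ... | yes _ = 1#
  ... | no  _ = 0#

  χ-≡ : ∀ {n} {z u : List (Fin n)} → u ≡ z → χ z u ≈ 1#
  χ-≡ {z = z} {u} u≡z with ≡-dec Fin._≟_ u z
  ... | yes _   = refl
  ... | no u≢z  = ⊥-elim (u≢z u≡z)

  χ-≢ : ∀ {n} {z u : List (Fin n)} → u ≢ z → χ z u ≈ 0#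
  χ-≢ {z = z} {u} u≢z with ≡-dec Fin._≟_ u z
  ... | yes u≡z = ⊥-elim (u≢z u≡z)
  ... | no _    = refl

  χ-∷ : ∀ {n} (v : Fin n) z u → χ (v ∷ z) (v ∷ u) ≈ χ z u
  χ-∷ v z u = case ≡-dec Fin._≟_ u z of λ where
    (yes u≡z) → trans (χ-≡ (≡.cong (v ∷_) u≡z)) (sym (χ-≡ u≡z))
    (no u≢z)  → trans (χ-≢ {u = v ∷ u} (u≢z ∘ ∷-injectiveʳ)) (sym (χ-≢ u≢z))

  listSum-χ : ∀ {n} {xs : List (List (Fin n))} {u} (g : List (Fin n) → Carrier) → Unique xs → u ∈ xs → listSum xs (λ y → g y * χ y u) ≈ g u
  listSum-χ {u = u} g xs-unique u∈xs = trans
    (listSum-single (λ y → g y * χ y u) xs-unique u∈xs λ {y} y≢u → trans (*-congˡ {g y} (χ-≢ (y≢u ∘ ≡.sym))) (zeroʳ _))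
    (trans (*-congˡ {g u} (χ-≡ {z = u} ≡.refl)) (*-identityʳ (g u)))

  -- In a list without repetitions, removals at different positions give different lists, so a
  -- single term of the alternating sum survives.
  ∂χ-removeAt : ∀ {n} (w : List (Fin n)) i → Unique w → -1^ (toℕ i) ≈ ∂ (χ (removeAt w i)) w
  ∂χ-removeAt (v ∷ vs) zero (v∉vs ∷ _) = sym (trans
    (+-cong (χ-≡ {z = vs} ≡.refl) (trans (-‿cong (∂-zero vs λ _ → χ-≢ (≢vs v∉vs))) -0#≈0#)) (+-identityʳ _))
    where
    ≢vs : ∀ {v u vs} → All (v ≢_) vs → v ∷ u ≢ vs
    ≢vs (v≢v ∷ _) ≡.refl = v≢v ≡.refl
  ∂χ-removeAt (v ∷ vs) (suc i) (v∉vs ∷ vs-unique) = begin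
    - 1# * -1^ (toℕ i)
      ≈⟨ -1*x≈-x _ ⟩
    - -1^ (toℕ i)
      ≈⟨ +-identityˡ _ ⟨
    0# - -1^ (toℕ i)
      ≈⟨ +-cong (χ-≢ (vs≢ v∉vs)) (-‿cong (trans (∂-cong vs λ {u} _ → χ-∷ v (removeAt vs i) u)
                                   (sym (∂χ-removeAt vs i vs-unique)))) ⟨
    χ (v ∷ removeAt vs i) vs - ∂ (χ (v ∷ removeAt vs i) ∘ (v ∷_)) vs ∎
    where
    vs≢ : ∀ {v u vs} → All (v ≢_) vs → vs ≢ v ∷ u
    vs≢ (v≢v ∷ _) ≡.refl = v≢v ≡.refl

-- Sublists of a given length.

module _ {a} {A : Set a} where

  choose-∷ : ∀ m {v : A} {vs x} → x ∈ choose m vs → x ∈ choose m (v ∷ vs)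
  choose-∷ zero    x∈ = x∈
  choose-∷ (suc m) x∈ = ∈-++⁺ʳ _ x∈

  choose-⁻ : ∀ m (v : A) vs {x} → x ∈ choose (suc m) (v ∷ vs) →
    (∃ λ u → u ∈ choose m vs × x ≡ v ∷ u) ⊎ x ∈ choose (suc m) vs
  choose-⁻ m v vs x∈ with ∈-++⁻ (map (v ∷_) (choose m vs)) x∈
  ... | inj₁ x∈ = inj₁ (∈-map⁻ (v ∷_) x∈)
  ... | inj₂ x∈ = inj₂ x∈

  choose-length : ∀ m (vs : List A) {x} → x ∈ choose m vs → length x ≡ m
  choose-length zero    vs       (here ≡.refl) = ≡.refl
  choose-length (suc m) (v ∷ vs) x∈ with choose-⁻ m v vs x∈
  ... | inj₁ (u , u∈ , ≡.refl) = ≡.cong suc (choose-length m vs u∈)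
  ... | inj₂ x∈                = choose-length (suc m) vs x∈

  choose-⊆ : ∀ m (vs : List A) {x v} → x ∈ choose m vs → v ∈ x → v ∈ vs
  choose-⊆ zero    vs       (here ≡.refl) ()
  choose-⊆ (suc m) (w ∷ vs) x∈ v∈x with choose-⁻ m w vs x∈
  choose-⊆ (suc m) (w ∷ vs) x∈ (here ≡.refl) | inj₁ (u , u∈ , ≡.refl) = here ≡.refl
  choose-⊆ (suc m) (w ∷ vs) x∈ (there v∈u)   | inj₁ (u , u∈ , ≡.refl) = there (choose-⊆ m vs u∈ v∈u)
  ... | inj₂ x∈                = there (choose-⊆ (suc m) vs x∈ v∈x)

  choose-Face : ∀ m (vs : List A) {x u} → x ∈ choose (suc m) vs → Face u x → u ∈ choose m vs
  choose-Face m (v ∷ vs) x∈ u⊂x with choose-⁻ m v vs x∈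
  choose-Face m       (v ∷ vs) x∈ here        | inj₁ (w , w∈ , ≡.refl) = choose-∷ m w∈
  choose-Face (suc m) (v ∷ vs) x∈ (there u⊂w) | inj₁ (w , w∈ , ≡.refl) =
    ∈-++⁺ˡ (∈-map⁺ (v ∷_) (choose-Face m vs w∈ u⊂w))
  choose-Face zero    (v ∷ vs) x∈ (there u⊂w) | inj₁ (w , here ≡.refl , ≡.refl) = case u⊂w of λ ()
  ... | inj₂ x∈ = choose-∷ m (choose-Face m vs x∈ u⊂x)

  choose-Unique : ∀ m {vs : List A} → Unique vs → Unique (choose m vs)
  choose-Unique zero    _ = [] ∷ []
  choose-Unique (suc m) [] = []
  choose-Unique (suc m) {v ∷ vs} (v∉vs ∷ vs-unique) = Unique.++⁺
    (Unique.map⁺ ∷-injectiveʳ (choose-Unique m vs-unique)) (choose-Unique (suc m) vs-unique)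
    λ where (x∈ , x∈′) → case ∈-map⁻ (v ∷_) x∈ of λ where
              (u , u∈ , ≡.refl) → All.lookup v∉vs (choose-⊆ (suc m) vs x∈′ (here ≡.refl)) ≡.refl

  choose-empty : ∀ m (vs : List A) → length vs ℕ.< m → choose m vs ≡ []
  choose-empty (suc m) []       _ = ≡.refl
  choose-empty (suc m) (v ∷ vs) (s≤s vs<m)
    rewrite choose-empty m vs vs<m | choose-empty (suc m) vs (ℕ.m<n⇒m<1+n vs<m) = ≡.refl

-- The simplices of a graph.

module SimplexLists {n} (G : SimpleGraph n) where
  open SimpleGraph G
  open Simplices G

  simplices-length : ∀ k {x} → x ∈ simplices k → length x ≡ suc k
  simplices-length k x∈ = choose-length (suc k) (allFin n) (proj₁ (∈-filter⁻ (allPairs? adj?) x∈))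

  simplices-vertices : ∀ k {x} → x ∈ simplices k → Unique x
  simplices-vertices k x∈ = AllPairs.map (λ adj v≡w → adj-irrefl v≡w adj)
    (proj₂ (∈-filter⁻ (allPairs? adj?) {xs = choose (suc k) (allFin n)} x∈))

  simplices-Face : ∀ k {x u} → x ∈ simplices (suc k) → Face u x → u ∈ simplices k
  simplices-Face k x∈ u⊂x with x∈choose , x-adj ← ∈-filter⁻ (allPairs? adj?) {xs = choose (suc (suc k)) (allFin n)} x∈ =
    ∈-filter⁺ (allPairs? adj?) (choose-Face (suc k) (allFin n) x∈choose u⊂x) (Face-AllPairs u⊂x x-adj)

  simplices-Unique : ∀ k → Unique (simplices k)
  simplices-Unique k = Unique.filter⁺ (allPairs? adj?) (choose-Unique (suc k) (Unique.allFin⁺ n))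

  dims-Unique : Unique dims
  dims-Unique = Unique.upTo⁺ levels

  -- The definition of `levels` inspects only dimensions below `n`. There a simplex would push the
  -- maximum beyond `k`; from `n` on, the vertices are too few for a sublist of length k + 1.
  simplices-empty : ∀ k → levels ℕ.≤ k → simplices k ≡ []
  simplices-empty k levels≤k with f k in fk
  ... | zero  = length≡0 fk
    where
    length≡0 : ∀ {a} {A : Set a} {xs : List A} → length xs ≡ 0 → xs ≡ []
    length≡0 {xs = []} _ = ≡.refl
  ... | suc _ = ⊥-elim (case k ℕ.<? n of λ where
    (yes k<n) → ℕ.<-irrefl ≡.refl (ℕ.<-≤-trans (v<max⁺ 0 _ (inj₂ (Any.map (λ { ≡.refl → ℕ.n<1+n k })
      (∈-map⁺ suc (∈-filter⁺ (λ k → 0 ℕ.<? f k) (∈-upTo⁺ k<n) (≡.subst (0 ℕ.<_) (≡.sym fk) (s≤s z≤n))))))) levels≤k)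
    (no k≮n)  → case ≡.trans (≡.sym fk) (≡.cong (length ∘ filter (allPairs? adj?))
      (choose-empty (suc k) (allFin n) (≡.subst (ℕ._< suc k) (≡.sym (length-tabulate id)) (s≤s (ℕ.≮⇒≥ k≮n))))) of λ ())

  ∈allSimplices : ∀ {x} → x ∈ allSimplices → ∃ λ k → x ∈ simplices k
  ∈allSimplices x∈ with k , x∈ ← Any.satisfied (∈-concatMap⁻ simplices {xs = dims} x∈) = k , x∈

-- The exterior derivative squares to zero, and the resulting factorisations of ρ.

module HodgeTheory {c ℓ₁ ℓ₂ ℓ₃} (K : OrderedField c ℓ₁ ℓ₂ ℓ₃) {n : ℕ} (G : SimpleGraph n) where
  open OrderedField K hiding (zero)
  open Hodge K G
  open CommutativeRing commutativeRing using (semiring)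
  open import Algebra.Properties.Semiring.Sum semiring
    using (sum; sum-cong-≋; ∑-distrib-+; ∑-comm; *-distribˡ-sum; *-distribʳ-sum)
  open import Relation.Binary.Reasoning.Setoid setoid
  open Determinants K
  open Chains K
  open SimplexLists G

  ⊗-assoc : ∀ {k l m n} (M : Matrix k l) (N : Matrix l m) (P : Matrix m n) → ((M ⊗ N) ⊗ P) ≋ᴹ (M ⊗ (N ⊗ P))
  ⊗-assoc {l = l} {m} M N P i j = begin
    sum {m} (λ b → sum {l} (λ a → M i a * N a b) * P b j)
      ≈⟨ sum-cong-≋ {m} (λ b → *-distribʳ-sum (P b j) (λ a → M i a * N a b)) ⟩
    sum {m} (λ b → sum {l} (λ a → M i a * N a b * P b j))
      ≈⟨ ∑-comm {m} {l} (λ b a → M i a * N a b * P b j) ⟩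
    sum {l} (λ a → sum {m} (λ b → M i a * N a b * P b j))
      ≈⟨ sum-cong-≋ {l} (λ a → trans (sum-cong-≋ {m} λ b → *-assoc (M i a) (N a b) (P b j))
                                      (sym (*-distribˡ-sum (M i a) (λ b → N a b * P b j)))) ⟩
    sum {l} (λ a → M i a * sum {m} (λ b → N a b * P b j)) ∎

  ⊗-zeroˡ : ∀ {l m n} {M : Matrix l m} (N : Matrix m n) → M ≋ᴹ 𝟘 → (M ⊗ N) ≋ᴹ 𝟘
  ⊗-zeroˡ {m = m} N M≋𝟘 i j = sum-zero {m} λ k → trans (*-congʳ (M≋𝟘 i k)) (zeroˡ (N k j))

  ⊗-zeroʳ : ∀ {l m n} (M : Matrix l m) {N : Matrix m n} → N ≋ᴹ 𝟘 → (M ⊗ N) ≋ᴹ 𝟘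
  ⊗-zeroʳ {m = m} M N≋𝟘 i j = sum-zero {m} λ k → trans (*-congˡ (N≋𝟘 k j)) (zeroʳ (M i k))

  ⊗-middle-zero : ∀ {k l m n p} (M : Matrix k l) (N : Matrix l m) (P : Matrix m n) (Q : Matrix n p) →
    (N ⊗ P) ≋ᴹ 𝟘 → ((M ⊗ N) ⊗ (P ⊗ Q)) ≋ᴹ 𝟘
  ⊗-middle-zero M N P Q NP≋𝟘 i j = trans (⊗-assoc M N (P ⊗ Q) i j)
    (⊗-zeroʳ M (λ i j → trans (sym (⊗-assoc N P Q i j)) (⊗-zeroˡ Q NP≋𝟘 i j)) i j)

  ⊗-distribˡ-⊕ : ∀ {l m n} (M : Matrix l m) (N P : Matrix m n) → (M ⊗ (N ⊕ P)) ≋ᴹ ((M ⊗ N) ⊕ (M ⊗ P))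
  ⊗-distribˡ-⊕ {m = m} M N P i j = trans (sum-cong-≋ {m} λ k → distribˡ (M i k) (N k j) (P k j))
    (∑-distrib-+ {m} (λ k → M i k * N k j) (λ k → M i k * P k j))

  ⊗-distribʳ-⊕ : ∀ {l m n} (M N : Matrix l m) (P : Matrix m n) → ((M ⊕ N) ⊗ P) ≋ᴹ ((M ⊗ P) ⊕ (N ⊗ P))
  ⊗-distribʳ-⊕ {m = m} M N P i j = trans (sum-cong-≋ {m} λ k → distribʳ (P k j) (M i k) (N i k))
    (∑-distrib-+ {m} (λ k → M i k * P k j) (λ k → N i k * P k j))

  -- This trades the search for a position in `sign` for an expression that is linear in the
  -- indicator, so that d d = 0 becomes an instance of `∂∂≈0`. Distinct vertices make the position
  -- found by the search the only one.
  sign-∂ : ∀ y x → Unique x → sign y x ≈ ∂ (χ y) x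
  sign-∂ y x x-unique with Fin.any? (λ i → ≡-dec Fin._≟_ (removeAt x i) y)
  ... | yes (i , ≡.refl) = ∂χ-removeAt x i x-unique
  ... | no ¬face         = sym (∂-zero x λ {u} u⊂x → χ-≢ {u = u} λ { ≡.refl → ¬face (Face-removeAt u⊂x) })

  sign-length : ∀ y x → length x ≢ suc (length y) → sign y x ≈ 0#
  sign-length y x ≢length with Fin.any? (λ i → ≡-dec Fin._≟_ (removeAt x i) y)
  ... | yes (i , ≡.refl) = ⊥-elim (≢length (length-removeAt′ x i))
  ... | no _             = refl

  -- All faces of a simplex are in `simplices k`. On them `g` is therefore the combination of the
  -- indicators of these simplices with coefficients `g y`, and `∂` commutes with the sum.
  listSum-sign : ∀ k {x} → x ∈ simplices (suc k) → ∀ g → listSum (simplices k) (λ y → sign y x * g y) ≈ ∂ g x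
  listSum-sign k {x} x∈ g = begin
    listSum (simplices k) (λ y → sign y x * g y)
      ≈⟨ listSum-cong (simplices k) (λ {y} _ → trans (*-comm (sign y x) (g y)) (*-congˡ {g y} (sign-∂ y x (simplices-vertices (suc k) x∈)))) ⟩
    listSum (simplices k) (λ y → g y * ∂ (χ y) x)
      ≈⟨ ∂-listSum (simplices k) g χ x ⟨
    ∂ (λ u → listSum (simplices k) (λ y → g y * χ y u)) x
      ≈⟨ ∂-cong x (λ u⊂x → listSum-χ g (simplices-Unique k) (simplices-Face k x∈ u⊂x)) ⟩
    ∂ g x ∎

  listSum-sign-sign : ∀ k {x} → x ∈ simplices (suc k) → ∀ z → listSum (simplices k) (λ y → sign y x * sign z y) ≈ 0#
  listSum-sign-sign k {x} x∈ z = begin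
    listSum (simplices k) (λ y → sign y x * sign z y)  ≈⟨ listSum-sign k x∈ (sign z) ⟩
    ∂ (sign z) x     ≈⟨ ∂-cong x (λ {u} u⊂x → sign-∂ z u (simplices-vertices k (simplices-Face k x∈ u⊂x))) ⟩
    ∂ (∂ (χ z)) x    ≈⟨ ∂∂≈0 (χ z) x ⟩
    0#               ∎

  d[k+1]⊗d[k] : ∀ k → (d[ suc k ] ⊗ d[ k ]) ≋ᴹ 𝟘
  d[k+1]⊗d[k] k i j = listSum-sign-sign (suc k) (∈-lookup i) (lookup (simplices k) j)

  ρ-L : ∀ k t → ρ L[ suc k ] t ≈ ρ D[ suc k ] t * ρ D[ k ] t
  ρ-L k t = trans
    (ρ-⊕ D[ suc k ] (d[ k ] ⊗ d[ k ] ᵀ) (⊗-middle-zero (d[ suc k ] ᵀ) d[ suc k ] d[ k ] (d[ k ] ᵀ) (d[k+1]⊗d[k] k)) t)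
    (*-congˡ (ρ-⊗-comm d[ k ] (d[ k ] ᵀ) t))

  -- Beyond the top dimension both sides are zero. That case is covered because `cofaces-Gram` uses
  -- dimension k + 1, which exceeds r when k = r.
  listSum-allSimplices : ∀ k g → (∀ y → length y ≢ suc k → g y ≈ 0#) →
    listSum allSimplices g ≈ listSum (simplices k) g
  listSum-allSimplices k g g≈0 = trans (listSum-concatMap simplices dims g) (case k ℕ.<? levels of λ where
      (yes k<levels) → listSum-single (λ k → listSum (simplices k) g) dims-Unique (∈-upTo⁺ k<levels) other
      (no k≮levels)  → trans (listSum-zero dims λ {k′} k′∈ → other λ { ≡.refl → k≮levels (∈-upTo⁻ k′∈) })
        (sym (reflexive (≡.cong (λ xs → listSum xs g) (simplices-empty k (ℕ.≮⇒≥ k≮levels))))))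
    where
    other : ∀ {k′} → k′ ≢ k → listSum (simplices k′) g ≈ 0#
    other {k′} k′≢k = listSum-zero (simplices k′) λ {y} y∈ →
      g≈0 y λ eq → k′≢k (ℕ.suc-injective (≡.trans (≡.sym (simplices-length k′ y∈)) eq))

  N : ℕ
  N = length allSimplices

  d⊗d : (d ⊗ d) ≋ᴹ 𝟘
  d⊗d i j with k , x∈ ← ∈allSimplices (∈-lookup i) = go k x∈
    where
    x = lookup allSimplices i
    z = lookup allSimplices j
    go : ∀ k → x ∈ simplices k → listSum allSimplices (λ y → sign y x * sign z y) ≈ 0#
    -- The only list obtained by removing an entry from a vertex is empty, and the empty list is not
    -- among the simplices.
    go zero x∈ = listSum-zero allSimplices λ {y} y∈ → trans
      (*-congʳ {sign z y} (sign-length y x λ eq → case ∈allSimplices y∈ of λ (k , y∈k) →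
        case ≡.trans (≡.sym (simplices-length 0 x∈)) (≡.trans eq (≡.cong suc (simplices-length k y∈k))) of λ ())) (zeroˡ _)
    go (suc k) x∈ = trans (listSum-allSimplices k (λ y → sign y x * sign z y) λ y ≢k → trans
      (*-congʳ (sign-length y x λ eq → ≢k (ℕ.suc-injective (≡.trans (≡.sym eq) (simplices-length (suc k) x∈))))) (zeroˡ _))
      (listSum-sign-sign k x∈ z)

  -- The columns of `d` that belong to the k-simplices. With C for this matrix, d d* is the sum of
  -- the C C* over all dimensions, while C* C is `D[ k ]`.
  cofaces : ∀ k → Matrix N (f k)
  cofaces k i b = sign (lookup (simplices k) b) (lookup allSimplices i)

  cofaces-Gram : ∀ k → (cofaces k ᵀ ⊗ cofaces k) ≋ᴹ D[ k ]
  cofaces-Gram k a b = listSum-allSimplices (suc k)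
    (λ x → sign (lookup (simplices k) a) x * sign (lookup (simplices k) b) x) λ x ≢k → trans
    (*-congʳ (sign-length _ x λ eq → ≢k (≡.trans eq (≡.cong suc (simplices-length k (∈-lookup a)))))) (zeroˡ _)

  -- No simplex lies one dimension above both k-simplices and l-simplices, so every summand has a
  -- zero factor.
  cofaces-orthogonal : ∀ {k l} → k ≢ l → (cofaces k ᵀ ⊗ cofaces l) ≋ᴹ 𝟘
  cofaces-orthogonal {k} {l} k≢l a b = listSum-zero allSimplices λ {x} _ → case length x ℕ.≟ suc (suc k) of λ where
    (yes eq) → trans (*-congˡ (sign-length _ x λ eq′ → k≢l (ℕ.suc-injective (ℕ.suc-injective
      (≡.trans (≡.sym eq) (≡.trans eq′ (≡.cong suc (simplices-length l (∈-lookup b))))))))) (zeroʳ _)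
    (no neq) → trans (*-congʳ (sign-length _ x λ eq → neq (≡.trans eq (≡.cong suc (simplices-length k (∈-lookup a)))))) (zeroˡ _)

  layers : List ℕ → Matrix N N
  layers ks i j = listSum ks (λ k → (cofaces k ⊗ cofaces k ᵀ) i j)

  ρ-layers : ∀ {ks} → Unique ks → ∀ t → ρ (layers ks) t ≈ foldr (λ k x → ρ D[ k ] t * x) 1# ks
  ρ-layers {[]}     _ t = ρ-𝟘 {M = layers []} (λ i j → refl) t
  ρ-layers {k ∷ ks} (k∉ks ∷ ks-unique) t = begin
    ρ ((cofaces k ⊗ cofaces k ᵀ) ⊕ layers ks) t
      ≈⟨ ρ-⊕ (cofaces k ⊗ cofaces k ᵀ) (layers ks) (orthogonal k∉ks) t ⟩
    ρ (cofaces k ⊗ cofaces k ᵀ) t * ρ (layers ks) t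
      ≈⟨ *-cong (trans (ρ-⊗-comm (cofaces k) (cofaces k ᵀ) t) (ρ-cong (cofaces-Gram k) t)) (ρ-layers ks-unique t) ⟩
    ρ D[ k ] t * foldr (λ k x → ρ D[ k ] t * x) 1# ks ∎
    where
    orthogonal : ∀ {ks} → All (k ≢_) ks → ((cofaces k ⊗ cofaces k ᵀ) ⊗ layers ks) ≋ᴹ 𝟘
    orthogonal []                       = ⊗-zeroʳ (cofaces k ⊗ cofaces k ᵀ) λ i j → refl
    orthogonal (_∷_ {l} {ks} k≢l k∉ks) i j = trans
      (⊗-distribˡ-⊕ (cofaces k ⊗ cofaces k ᵀ) (cofaces l ⊗ cofaces l ᵀ) (layers ks) i j)
      (trans (+-cong (⊗-middle-zero (cofaces k) (cofaces k ᵀ) (cofaces l) (cofaces l ᵀ) (cofaces-orthogonal k≢l) i j)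
                     (orthogonal k∉ks i j)) (+-identityˡ _))

  d⊗dᵀ : (d ⊗ d ᵀ) ≋ᴹ layers dims
  d⊗dᵀ i j = listSum-concatMap simplices dims (λ y → sign y (lookup allSimplices i) * sign y (lookup allSimplices j))

  ρ-D⊗D : ∀ t → ρ (D ⊗ D) t ≈ foldr (λ k x → ρ D[ k ] t * x) 1# dims * foldr (λ k x → ρ D[ k ] t * x) 1# dims
  ρ-D⊗D t = begin
    ρ (D ⊗ D) t                          ≈⟨ ρ-cong D⊗D t ⟩
    ρ ((d ⊗ d ᵀ) ⊕ (d ᵀ ⊗ d)) t          ≈⟨ ρ-⊕ (d ⊗ d ᵀ) (d ᵀ ⊗ d) (⊗-middle-zero d (d ᵀ) (d ᵀ) d dᵀ⊗dᵀ) t ⟩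
    ρ (d ⊗ d ᵀ) t * ρ (d ᵀ ⊗ d) t        ≈⟨ *-congˡ (ρ-⊗-comm (d ᵀ) d t) ⟩
    ρ (d ⊗ d ᵀ) t * ρ (d ⊗ d ᵀ) t        ≈⟨ *-cong ρ-d⊗dᵀ ρ-d⊗dᵀ ⟩
    foldr (λ k x → ρ D[ k ] t * x) 1# dims * foldr (λ k x → ρ D[ k ] t * x) 1# dims ∎
    where
    dᵀ⊗dᵀ : (d ᵀ ⊗ d ᵀ) ≋ᴹ 𝟘
    dᵀ⊗dᵀ i j = trans (sum-cong-≋ {N} λ k → *-comm (d k i) (d j k)) (d⊗d j i)
    D⊗D : (D ⊗ D) ≋ᴹ ((d ⊗ d ᵀ) ⊕ (d ᵀ ⊗ d))
    D⊗D i j = begin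
      (D ⊗ D) i j
        ≈⟨ ⊗-distribʳ-⊕ d (d ᵀ) D i j ⟩
      (d ⊗ D) i j + (d ᵀ ⊗ D) i j
        ≈⟨ +-cong (⊗-distribˡ-⊕ d d (d ᵀ) i j) (⊗-distribˡ-⊕ (d ᵀ) d (d ᵀ) i j) ⟩
      (d ⊗ d) i j + (d ⊗ d ᵀ) i j + ((d ᵀ ⊗ d) i j + (d ᵀ ⊗ d ᵀ) i j)
        ≈⟨ +-cong (trans (+-congʳ (d⊗d i j)) (+-identityˡ _)) (trans (+-congˡ (dᵀ⊗dᵀ i j)) (+-identityʳ _)) ⟩
      (d ⊗ d ᵀ) i j + (d ᵀ ⊗ d) i j ∎
    ρ-d⊗dᵀ : ρ (d ⊗ d ᵀ) t ≈ foldr (λ k x → ρ D[ k ] t * x) 1# dims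
    ρ-d⊗dᵀ = trans (ρ-cong d⊗dᵀ t) (ρ-layers dims-Unique t)

-- Divisibility steers the filters and the power of -1 steers the exponents, so both are carried
-- along. `Odd` also records that the successor is even, from which the next step of `parity` is
-- immediate.
Even Odd : ℕ → Set
Even k = 2 ∣ k × ℤ.-1ℤ ℤ.^ k ≡ ℤ.1ℤ
Odd k  = ¬ 2 ∣ k × 2 ∣ suc k × ℤ.-1ℤ ℤ.^ k ≡ ℤ.-1ℤ

Even⇒Odd : ∀ {k} → Even k → Odd (suc k)
Even⇒Odd {k} (2∣k , eq) =
  (λ 2∣1+k → case ∣1⇒≡1 (∣m+n∣m⇒∣n (≡.subst (2 ∣_) (ℕ.+-comm 1 k) 2∣1+k) 2∣k) of λ ()) ,
  ∣m∣n⇒∣m+n ∣-refl 2∣k , ≡.cong (ℤ.-1ℤ ℤ.*_) eq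

Odd⇒Even : ∀ {k} → Odd k → Even (suc k)
Odd⇒Even (_ , 2∣1+k , eq) = 2∣1+k , ≡.cong (ℤ.-1ℤ ℤ.*_) eq

parity : ∀ k → Even k ⊎ Odd k
parity zero    = inj₁ (2 ∣0 , ≡.refl)
parity (suc k) with parity k
... | inj₁ even = inj₂ (Even⇒Odd even)
... | inj₂ odd  = inj₁ (Odd⇒Even odd)

-- Integer powers, finite products and the telescoping of the torsion.

module Powers {c ℓ₁ ℓ₂ ℓ₃} (K : OrderedField c ℓ₁ ℓ₂ ℓ₃) where
  open OrderedField K hiding (zero)
  open LinearAlgebra K
  open CommutativeRing commutativeRing using (semiring; commutativeSemiring)
  open import Algebra.Definitions.RawSemiring (Semiring.rawSemiring semiring) using () renaming (_^_ to _^ᴷ_)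
  open import Algebra.Properties.CommutativeSemiring.Exp commutativeSemiring using (^-congˡ; ^-distrib-*)
  open import Algebra.Apartness.Properties.HeytingCommutativeRing heytingCommutativeRing
  open import Relation.Binary.Reasoning.Setoid setoid
  open IntegerSolver commutativeRing

  ⁻¹-inverseˡ : ∀ a → val (a ⁻¹) * val a ≈ 1#
  ⁻¹-inverseˡ (x , x#0) with #⇒invertible x#0
  ... | x⁻¹ , x⁻¹x≈1 , _ = trans (*-congˡ (sym (x-0≈x x))) x⁻¹x≈1

  val-^ : ∀ a k → val (a ^ (+ k)) ≈ val a ^ᴷ k
  val-^ a zero    = refl
  val-^ a (suc k) = *-congˡ (val-^ a k)

  val-^-neg : ∀ a k → val (a ^ (ℤ.- (+ k))) * val a ^ᴷ k ≈ 1#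
  val-^-neg a zero          = *-identityˡ 1#
  val-^-neg a (suc zero)    = trans (*-congˡ (*-identityʳ _)) (⁻¹-inverseˡ a)
  val-^-neg a (suc (suc k)) = begin
    val (a ⁻¹) * val (a ^ -[1+ k ]) * (val a * val a ^ᴷ suc k)
      ≈⟨ solve 4 (λ i p x y → i :* p :* (x :* y) := i :* x :* (p :* y)) refl
           (val (a ⁻¹)) (val (a ^ -[1+ k ])) (val a) (val a ^ᴷ suc k) ⟩
    val (a ⁻¹) * val a * (val (a ^ -[1+ k ]) * val a ^ᴷ suc k)
      ≈⟨ *-cong (⁻¹-inverseˡ a) (val-^-neg a (suc k)) ⟩
    1# * 1#
      ≈⟨ *-identityˡ 1# ⟩
    1# ∎

  1^ᴷ : ∀ k → 1# ^ᴷ k ≈ 1#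
  1^ᴷ zero    = refl
  1^ᴷ (suc k) = trans (*-identityˡ _) (1^ᴷ k)

  -- Compares products by their values alone: converting the proofs that the factors
  -- are nonzero into each other is prohibitively slow.
  ∏-foldr : ∀ {i} {I : Set i} (f : I → K× → K×) (g : I → K×) → (∀ i a → val (f i a) ≈ val (g i) * val a) →
    ∀ is → val (foldr f 𝟙 is) ≈ val (∏ is g)
  ∏-foldr f g f≈g []       = refl
  ∏-foldr f g f≈g (i ∷ is) = trans (f≈g i _) (*-congˡ (∏-foldr f g f≈g is))

  module _ {i} {I : Set i} (g : I → K×) where

    ∏-∷ʳ : ∀ is i → val (∏ (is ∷ʳ i) g) ≈ val (∏ is g) * val (g i)
    ∏-∷ʳ []       i = trans (*-identityʳ _) (sym (*-identityˡ _))
    ∏-∷ʳ (j ∷ is) i = trans (*-congˡ (∏-∷ʳ is i)) (sym (*-assoc _ _ _))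

    ∏-filter : ∀ {p} {P : Pred I p} (P? : Decidable P) is →
      val (∏ is g) ≈ val (∏ (filter P? is) g) * val (∏ (filter (λ i → ¬? (P? i)) is) g)
    ∏-filter P? []       = sym (*-identityˡ 1#)
    ∏-filter P? (i ∷ is) with P? i
    ... | yes _ = trans (*-congˡ (∏-filter P? is)) (sym (*-assoc _ _ _))
    ... | no _  = trans (*-congˡ (∏-filter P? is))
      (solve 3 (λ x y z → x :* (y :* z) := y :* (x :* z)) refl (val (g i)) _ _)

    ∏-^2 : ∀ is → val (∏[ i ← is ] g i ^ (+ 2)) ≈ val (∏ is g) * val (∏ is g)
    ∏-^2 []       = sym (*-identityˡ 1#)
    ∏-^2 (i ∷ is) = trans (*-congˡ (∏-^2 is))
      (solve 2 (λ x y → x :* (x :* con (+ 1)) :* (y :* y) := x :* y :* (x :* y)) refl (val (g i)) (val (∏ is g)))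

  -- Telescoping: if Q (k + 1) = P (k + 1) P k, the product of Q k to the power
  -- k (-1)^(k+1) over k < m is that of P k to the power (-1)^k, up to a power of P (m - 1).
  module Telescope (P Q : ℕ → K×) (Q≈ : ∀ k → val (Q (suc k)) ≈ val (P (suc k)) * val (P k)) where

    -- The value at 0 is the pseudo determinant that belongs to the zero map d₋₁.
    previous : ℕ → Carrier
    previous zero    = 1#
    previous (suc k) = val (P k)

    T E O : ℕ → Carrier
    T m = val (∏[ k ← upTo m ] Q k ^ (+ k ℤ.* (ℤ.-1ℤ ℤ.^ suc k)))
    E m = val (∏[ k ← filter (2 ∣?_) (upTo m) ] P k)
    O m = val (∏[ k ← filter (λ k → ¬? (2 ∣? k)) (upTo m) ] P k)

    Q^ : ∀ m → val (Q m) ^ᴷ m ≈ val (P m) ^ᴷ m * previous m ^ᴷ m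
    Q^ zero    = sym (*-identityˡ 1#)
    Q^ (suc k) = trans (^-congˡ (suc k) (Q≈ k)) (^-distrib-* _ _ (suc k))

    T-suc : ∀ m → T (suc m) ≈ T m * val (Q m ^ (+ m ℤ.* (ℤ.-1ℤ ℤ.^ suc m)))
    T-suc m = trans (reflexive (≡.cong (λ ks → val (∏[ k ← ks ] Q k ^ (+ k ℤ.* (ℤ.-1ℤ ℤ.^ suc k)))) (≡.sym (upTo-∷ʳ m))))
      (∏-∷ʳ (λ k → Q k ^ (+ k ℤ.* (ℤ.-1ℤ ℤ.^ suc k))) (upTo m) m)

    module _ {p} {R : Pred ℕ p} (R? : Decidable R) where

      filtered : ℕ → Carrier
      filtered m = val (∏[ k ← filter R? (upTo m) ] P k)

      filter-suc : ∀ m → filter R? (upTo (suc m)) ≡ filter R? (upTo m) ++ filter R? [ m ]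
      filter-suc m = ≡.trans (≡.cong (filter R?) (≡.sym (upTo-∷ʳ m))) (filter-++ R? (upTo m) [ m ])

      filtered-accept : ∀ {m} → R m → filtered (suc m) ≈ filtered m * val (P m)
      filtered-accept {m} Rm = trans (reflexive (≡.cong (λ ks → val (∏ ks P))
        (≡.trans (filter-suc m) (≡.cong (filter R? (upTo m) ++_) (filter-accept R? Rm))))) (∏-∷ʳ P (filter R? (upTo m)) m)

      filtered-reject : ∀ {m} → ¬ R m → filtered (suc m) ≈ filtered m
      filtered-reject {m} ¬Rm = reflexive (≡.cong (λ ks → val (∏ ks P))
        (≡.trans (filter-suc m) (≡.trans (≡.cong (filter R? (upTo m) ++_) (filter-reject R? ¬Rm)) (++-identityʳ _))))

    -- Both forms are multiplied out so that E, O and the boundary power need no inverses. The last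
    -- factor of `T m` has an exponent of sign (-1)^m, so the boundary power stands on the right for
    -- even `m` and on the left for odd `m`.
    telescope-even : ∀ m → Even m → T m * O m ≈ E m * previous m ^ᴷ m
    telescope-odd  : ∀ m → Odd m → T m * O m * previous m ^ᴷ m ≈ E m

    telescope-even zero    _ = refl
    telescope-even (suc m) (2∣1+m , _) with parity m
    ... | inj₁ even = ⊥-elim (proj₁ (Even⇒Odd even) 2∣1+m)
    ... | inj₂ odd@(2∤m , _ , -1^m) = begin
      T (suc m) * O (suc m)
        ≈⟨ *-cong (T-suc m) (filtered-accept (λ k → ¬? (2 ∣? k)) 2∤m) ⟩
      T m * val (Q m ^ (+ m ℤ.* (ℤ.-1ℤ ℤ.^ suc m))) * (O m * val (P m))
        -- `Q m` to the power m splits in two: `previous m ^ᴷ m` is what `telescope-odd m` asks for,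
        -- and `val (P m) ^ᴷ m` joins the new odd factor to form the next boundary power.
        ≈⟨ *-congʳ (*-congˡ (trans (reflexive (≡.cong (λ e → val (Q m ^ e)) exponent)) (trans (val-^ (Q m) m) (Q^ m)))) ⟩
      T m * (val (P m) ^ᴷ m * previous m ^ᴷ m) * (O m * val (P m))
        ≈⟨ solve 5 (λ t u w o p → t :* (u :* w) :* (o :* p) := t :* o :* w :* (p :* u)) refl
             (T m) (val (P m) ^ᴷ m) (previous m ^ᴷ m) (O m) (val (P m)) ⟩
      T m * O m * previous m ^ᴷ m * (val (P m) * val (P m) ^ᴷ m)
        ≈⟨ *-congʳ (telescope-odd m odd) ⟩
      E m * (val (P m) * val (P m) ^ᴷ m)
        ≈⟨ *-congʳ (filtered-reject (2 ∣?_) 2∤m) ⟨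
      E (suc m) * val (P m) ^ᴷ suc m ∎
      where
      exponent : + m ℤ.* (ℤ.-1ℤ ℤ.^ suc m) ≡ + m
      exponent = ≡.trans (≡.cong (λ e → + m ℤ.* (ℤ.-1ℤ ℤ.* e)) -1^m) (ℤ.*-identityʳ (+ m))

    telescope-odd zero    (2∤0 , _) = ⊥-elim (2∤0 (2 ∣0))
    telescope-odd (suc m) (2∤1+m , _) with parity m
    ... | inj₂ odd = ⊥-elim (2∤1+m (proj₁ (Odd⇒Even odd)))
    ... | inj₁ even@(2∣m , -1^m) = begin
      T (suc m) * O (suc m) * (val (P m) * val (P m) ^ᴷ m)
        ≈⟨ *-congʳ (*-cong (T-suc m) (filtered-reject (λ k → ¬? (2 ∣? k)) λ 2∤m → 2∤m 2∣m)) ⟩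
      T m * q * O m * (val (P m) * val (P m) ^ᴷ m)
        ≈⟨ solve 5 (λ t q o p u → t :* q :* o :* (p :* u) := t :* o :* (q :* u :* p)) refl
             (T m) q (O m) (val (P m)) (val (P m) ^ᴷ m) ⟩
      T m * O m * (q * val (P m) ^ᴷ m * val (P m))
        ≈⟨ *-congʳ (telescope-even m even) ⟩
      E m * previous m ^ᴷ m * (q * val (P m) ^ᴷ m * val (P m))
        ≈⟨ solve 5 (λ e w q u p → e :* w :* (q :* u :* p) := e :* p :* (q :* (u :* w))) refl
             (E m) (previous m ^ᴷ m) q (val (P m) ^ᴷ m) (val (P m)) ⟩
      E m * val (P m) * (q * (val (P m) ^ᴷ m * previous m ^ᴷ m))
        -- Here `q` is `Q m` to the power -m; the boundary power of the even case and the new one on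
        -- the left together make up `Q m` to the power m, and the two cancel.
        ≈⟨ *-congˡ (trans (*-cong (reflexive (≡.cong (λ e → val (Q m ^ e)) exponent)) (sym (Q^ m))) (val-^-neg (Q m) m)) ⟩
      E m * val (P m) * 1#
        ≈⟨ *-identityʳ _ ⟩
      E m * val (P m)
        ≈⟨ filtered-accept (2 ∣?_) 2∣m ⟨
      E (suc m) ∎
      where
      q : Carrier
      q = val (Q m ^ (+ m ℤ.* (ℤ.-1ℤ ℤ.^ suc m)))
      exponent : + m ℤ.* (ℤ.-1ℤ ℤ.^ suc m) ≡ ℤ.- (+ m)
      exponent = ≡.trans (≡.cong (λ e → + m ℤ.* (ℤ.-1ℤ ℤ.* e)) -1^m)
        (≡.trans (ℤ.*-comm (+ m) ℤ.-1ℤ) (ℤ.-1*i≡-i (+ m)))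

    telescope : ∀ m → previous m ≈ 1# → T m * O m ≈ E m
    telescope m previous≈1 with parity m
    ... | inj₁ even = trans (telescope-even m even) (trans (*-congˡ previous^≈1) (*-identityʳ _))
      where previous^≈1 = trans (^-congˡ m previous≈1) (1^ᴷ m)
    ... | inj₂ odd  = trans (sym (trans (*-congˡ previous^≈1) (*-identityʳ _))) (telescope-odd m odd)
      where previous^≈1 = trans (^-congˡ m previous≈1) (1^ᴷ m)

    module _ (m : ℕ) (previous≈1 : previous m ≈ 1#) (x t : K×)
             (x≈ : val x ≈ val (∏[ k ← upTo m ] P k)) (t≈ : val t ≈ T m) where

      x≈EO : val x ≈ E m * O m
      x≈EO = trans x≈ (∏-filter P (2 ∣?_) (upTo m))

      tO≈E : val t * O m ≈ E m
      tO≈E = trans (*-congʳ t≈) (telescope m previous≈1)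

      telescope-· : val (x · t) ≈ val (∏[ k ← filter (2 ∣?_) (upTo m) ] P k ^ (+ 2))
      telescope-· = begin
        val x * val t           ≈⟨ *-congʳ x≈EO ⟩
        E m * O m * val t       ≈⟨ trans (*-assoc (E m) (O m) (val t)) (*-congˡ (*-comm (O m) (val t))) ⟩
        E m * (val t * O m)     ≈⟨ *-congˡ tO≈E ⟩
        E m * E m               ≈⟨ ∏-^2 P (filter (2 ∣?_) (upTo m)) ⟨
        val (∏[ k ← filter (2 ∣?_) (upTo m) ] P k ^ (+ 2)) ∎

      telescope-÷ : val (x ÷ t) ≈ val (∏[ k ← filter (λ k → ¬? (2 ∣? k)) (upTo m) ] P k ^ (+ 2))
      telescope-÷ = begin
        val x * t⁻¹                 ≈⟨ *-congʳ (trans x≈EO (*-congʳ (sym tO≈E))) ⟩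
        val t * O m * O m * t⁻¹     ≈⟨ solve 3 (λ t o i → t :* o :* o :* i := i :* t :* (o :* o)) refl (val t) (O m) t⁻¹ ⟩
        t⁻¹ * val t * (O m * O m)   ≈⟨ trans (*-congʳ (⁻¹-inverseˡ t)) (*-identityˡ _) ⟩
        O m * O m                   ≈⟨ ∏-^2 P (filter (λ k → ¬? (2 ∣? k)) (upTo m)) ⟨
        val (∏[ k ← filter (λ k → ¬? (2 ∣? k)) (upTo m) ] P k ^ (+ 2)) ∎
        where t⁻¹ = val (t ⁻¹)

corollary6 : ∀ {c ℓ₁ ℓ₂ ℓ₃} (K : OrderedField c ℓ₁ ℓ₂ ℓ₃) {n : ℕ} (G : SimpleGraph n) →
    let open Hodge K G in
    (σD : Spectrum D) (σDₖ : ∀ k → Spectrum D[ k ]) (σLₖ : ∀ k → Spectrum L[ k ]) →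
    (∣ Det σD ∣ · torsion² σLₖ ≈× (∏[ k ← evenDims ] Det (σDₖ k) ^ (+ 2))) ×
    (∣ Det σD ∣ ÷ torsion² σLₖ ≈× (∏[ k ← oddDims ] Det (σDₖ k) ^ (+ 2)))
corollary6 K G σD σDₖ σLₖ =
  trans (telescope-· levels previous-levels ∣DetD∣ A ∣DetD∣≈ A≈) (sym (∏-foldr _ _ (λ k a → refl) evenDims)) ,
  trans (telescope-÷ levels previous-levels ∣DetD∣ A ∣DetD∣≈ A≈) (sym (∏-foldr _ _ (λ k a → refl) oddDims))
  where
  open OrderedField K hiding (zero)
  open Hodge K G
  open Chains K using (listSum)
  open SimplexLists G
  open HodgeTheory K G
  open Spectra K
  open Powers K
  open Telescope (λ k → Det (σDₖ k)) (λ k → Det (σLₖ k))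
    (λ k → Det-* (σLₖ (suc k)) (σDₖ (suc k)) (σDₖ k) (ρ-L k))

  -- Past the top dimension d has no rows, so the last Dirac block is zero and its pseudo
  -- determinant is an empty product: the boundary term of the telescope disappears. The bound on a
  -- variable `m` allows a case split that the defined number `levels` would not.
  previous≈1 : ∀ m → levels ℕ.≤ m → previous m ≈ 1#
  previous≈1 zero    _ = refl
  previous≈1 (suc k) levels≤ = Det-𝟘 (σDₖ k) λ i j → reflexive
    (≡.cong (λ xs → listSum xs λ x → sign (lookup (simplices k) i) x * sign (lookup (simplices k) j) x)
      (simplices-empty (suc k) levels≤))

  previous-levels : previous levels ≈ 1#
  previous-levels = previous≈1 levels ℕ.≤-refl

  ∣DetD∣ A : K×
  ∣DetD∣ = ∣ Det σD ∣
  A = torsion² σLₖ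

  ∣DetD∣≈ : val ∣DetD∣ ≈ val (∏[ k ← dims ] Det (σDₖ k))
  ∣DetD∣≈ = ∣Det∣-blocks σD dims σDₖ ρ-D⊗D

  A≈ : val A ≈ T levels
  A≈ = ∏-foldr _ (λ k → Det (σLₖ k) ^ (+ k ℤ.* (ℤ.-1ℤ ℤ.^ suc k))) (λ k a → refl) dims
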